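{- Let $W$ be a real 2-dimensional vector space, $m\ge2$, and let $\varphi:S^mW^*\hookrightarrow(W^*)^{\otimes m}$ be the Veronese factorization structure, with (common) factorization curve $\psi:\mathbb{P}(W)\to\mathbb{P}(S^mW^*)$, $\psi(\ell)=(\ell^0)^{\otimes m}$. Let $\sigma^\vee\subset S^mW^*$ be a full-dimensional pointed convex polyhedral cone each of whose extremal rays lies on a line $\psi(t)$ for some $t\in\mathbb{P}(W)$. Then $\sigma^\vee$ is a cone over a simplicial polytope: every facet of $\sigma^\vee$ contains exactly $m$ extremal rays, and these are linearly independent.
   Context: $S^mW^*\subset(W^*)^{\otimes m}$ is the subspace of symmetric tensors (of dimension $m+1$); $\ell^0\subset W^*$ denotes the annihilator of a line $\ell\subset W$, and $(\ell^0)^{\otimes m}$ is the line spanned by $\alpha\otimes\cdots\otimes\alpha$ for $0\ne\alpha\in\ell^0$ (its image is the rational normal curve of degree $m$). A convex polyhedral cone is the set of nonnegative combinations of finitely many vectors; it is pointed if it contains no nontrivial linear subspace; an extremal ray is a 1-dimensional face, a facet a codimension-one face. -}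

module Defs where

open import Level using (0ℓ)
open import Algebra.Bundles using (CommutativeRing)
open import Algebra.Module.Bundles using (Module)
open import Algebra.Module.Structures.Biased using (IsModuleFromLeft)
open import Algebra.Module.Morphism.Structures using (module LeftModuleMorphisms)
import Algebra.Module.Construct.TensorUnit as TensorUnit
import Algebra.Definitions.RawMonoid as RawMonoidDefinitions
import Algebra.Properties.AbelianGroup as AbelianGroupProperties
import Algebra.Properties.CommutativeSemigroup as CommutativeSemigroupProperties
import Algebra.Properties.Ring as RingProperties
open import Data.Fin.Base using (Fin)
open import Data.Fin.Permutation using (Permutation′; _⟨$⟩ʳ_)
open import Data.Nat.Base using (ℕ; suc)
open import Data.Product.Base using (Σ; ∃; ∃-syntax; _×_; _,_; proj₁; proj₂)
open import Data.Sum.Base using (_⊎_)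
open import Data.Vec.Functional using (Vector; updateAt)
open import Function.Base using (_∘_; const; flip)
open import Relation.Binary.Core using (Rel)
open import Relation.Binary.Structures using (IsStrictTotalOrder)
open import Relation.Binary.PropositionalEquality.Core using (_≡_)
open import Relation.Nullary.Negation using (¬_)
open import Relation.Unary using (Pred; _∈_; _⊆_; _≐_; U)

-- The real numbers, characterised up to isomorphism as a Dedekind-complete
-- ordered field.  The order is trichotomous and suprema are taken in the form
-- "an upper bound below which nothing is an upper bound", with the exceeding
-- element exhibited; applied to {0} ∪ {1 ∣ A}, the supremum decides A, so that
-- excluded middle for Set is a consequence and the reals are the classical ones.
record CompleteOrderedField : Set₁ where
  field
    commutativeRing : CommutativeRing 0ℓ 0ℓ

  open CommutativeRing commutativeRing public

  infix 4 _<_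
  field
    _<_                : Rel Carrier 0ℓ
    isStrictTotalOrder : IsStrictTotalOrder _≈_ _<_
    0<1                : 0# < 1#
    +-monoʳ-<          : ∀ x {y z} → y < z → x + y < x + z
    *-pos              : ∀ {x y} → 0# < x → 0# < y → 0# < x * y
    inverse            : ∀ x → ¬ (x ≈ 0#) → ∃[ y ] x * y ≈ 1#

  infix 4 _≤_
  _≤_ : Rel Carrier 0ℓ
  x ≤ y = x < y ⊎ x ≈ y

  IsUpperBound : Pred Carrier 0ℓ → Carrier → Set
  IsUpperBound P b = ∀ x → x ∈ P → x ≤ b

  IsSupremum : Pred Carrier 0ℓ → Carrier → Set
  IsSupremum P s =
    IsUpperBound P s × (∀ y → y < s → ∃[ x ] (x ∈ P × y < x))

  field
    supremum : (P : Pred Carrier 0ℓ) →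
               ∃ P → ∃ (IsUpperBound P) → ∃ (IsSupremum P)

module RealGeometry (ℝ : CompleteOrderedField) where

  open CompleteOrderedField ℝ
    using (commutativeRing; ring; rawRing; _≈_; _≤_; _+_; _*_; -_; 0#; 1#)
  module ℝ = CompleteOrderedField ℝ

  VectorSpace : Set₁
  VectorSpace = Module commutativeRing 0ℓ 0ℓ

  ∣_∣ : VectorSpace → Set
  ∣_∣ = Module.Carrierᴹ

  module _ (V : VectorSpace) where
    open Module V using (_≈ᴹ_; _≉ᴹ_; _+ᴹ_; _*ₗ_; 0ᴹ; +ᴹ-rawMonoid)
    open RawMonoidDefinitions +ᴹ-rawMonoid using (sum)

    linearCombination : ∀ {n} → Vector ℝ.Carrier n → Vector ∣ V ∣ n → ∣ V ∣
    linearCombination c v = sum (λ i → c i *ₗ v i)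

    LinearlyIndependent : ∀ {n} → Vector ∣ V ∣ n → Set
    LinearlyIndependent v =
      ∀ c → linearCombination c v ≈ᴹ 0ᴹ → ∀ i → c i ≈ 0#

    Span : Pred ∣ V ∣ 0ℓ → Pred ∣ V ∣ 0ℓ
    Span S x = ∃[ n ] Σ (Vector ∣ V ∣ n) λ v → ∃[ c ]
      ((∀ i → v i ∈ S) × x ≈ᴹ linearCombination c v)

    record IsSubspace (L : Pred ∣ V ∣ 0ℓ) : Set where
      field
        resp : ∀ {x y} → x ≈ᴹ y → x ∈ L → y ∈ L
        0∈   : 0ᴹ ∈ L
        +∈   : ∀ {x y} → x ∈ L → y ∈ L → x +ᴹ y ∈ L
        *∈   : ∀ a {x} → x ∈ L → a *ₗ x ∈ L

    HasDimension : Pred ∣ V ∣ 0ℓ → ℕ → Set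
    HasDimension L n = Σ (Vector ∣ V ∣ n) λ b →
      (∀ i → b i ∈ L) ×
      LinearlyIndependent b ×
      (∀ x → x ∈ L → ∃[ c ] x ≈ᴹ linearCombination c b)

    ℙ : Set₁
    ℙ = Σ (Pred ∣ V ∣ 0ℓ) λ L → IsSubspace L × HasDimension L 1

    ConicalHull : ∀ {k} → Vector ∣ V ∣ k → Pred ∣ V ∣ 0ℓ
    ConicalHull g x = ∃[ c ] ((∀ i → 0# ≤ c i) × x ≈ᴹ linearCombination c g)

    IsConvexPolyhedralCone : Pred ∣ V ∣ 0ℓ → Set
    IsConvexPolyhedralCone C =
      ∃[ k ] Σ (Vector ∣ V ∣ k) λ g → C ≐ ConicalHull g

    IsPointed : Pred ∣ V ∣ 0ℓ → Set₁
    IsPointed C = ∀ L → IsSubspace L → L ⊆ C → ∀ x → x ∈ L → x ≈ᴹ 0ᴹ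

    IsFullDimensional : Pred ∣ V ∣ 0ℓ → Set
    IsFullDimensional C = ∀ x → x ∈ Span C

    record IsConvexCone (C : Pred ∣ V ∣ 0ℓ) : Set where
      field
        resp : ∀ {x y} → x ≈ᴹ y → x ∈ C → y ∈ C
        0∈   : 0ᴹ ∈ C
        +∈   : ∀ {x y} → x ∈ C → y ∈ C → x +ᴹ y ∈ C
        *∈   : ∀ {a x} → 0# ≤ a → x ∈ C → a *ₗ x ∈ C

    -- A face of a cone is a subcone which contains the endpoints of every
    -- segment of the cone that it meets in an interior point.  As all sets
    -- involved are cones, the interior point can be rescaled to x + y.
    record IsFace (C F : Pred ∣ V ∣ 0ℓ) : Set where
      field
        isConvexCone : IsConvexCone F
        F⊆C          : F ⊆ C
        extreme      : ∀ {x y} → x ∈ C → y ∈ C → x +ᴹ y ∈ F → x ∈ F × y ∈ F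

    -- The dimension of a cone is that of its linear span.
    HasConeDimension : Pred ∣ V ∣ 0ℓ → ℕ → Set
    HasConeDimension C = HasDimension (Span C)

    IsExtremalRay : (C R : Pred ∣ V ∣ 0ℓ) → Set
    IsExtremalRay C R = IsFace C R × HasConeDimension R 1

    IsFacet : (C F : Pred ∣ V ∣ 0ℓ) → Set
    IsFacet C F =
      IsFace C F × ∃[ n ] (HasConeDimension F n × HasConeDimension C (suc n))

    record AreTheExtremalRaysIn (C F : Pred ∣ V ∣ 0ℓ) {n}
                                (ρ : Vector (Pred ∣ V ∣ 0ℓ) n) : Set₁ where
      field
        isExtremalRay : ∀ i → IsExtremalRay C (ρ i)
        ρ⊆F           : ∀ i → ρ i ⊆ F
        distinct      : ∀ i j → ρ i ≐ ρ j → i ≡ j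
        exhaustive    : ∀ R → IsExtremalRay C R → R ⊆ F → ∃[ i ] R ≐ ρ i

    -- Independence of rays is that of (arbitrary) nonzero vectors on them.
    LinearlyIndependentRays : ∀ {n} → Vector (Pred ∣ V ∣ 0ℓ) n → Set
    LinearlyIndependentRays ρ =
      ∀ v → (∀ i → v i ∈ ρ i) → (∀ i → v i ≉ᴹ 0ᴹ) → LinearlyIndependent v

    -- For a pointed polyhedral cone, whose facets are the cones over the facets
    -- of a bounded cross-section, this says that the cross-section is a
    -- simplicial polytope of dimension n.
    IsConeOverSimplicialPolytope : Pred ∣ V ∣ 0ℓ → ℕ → Set₁
    IsConeOverSimplicialPolytope C n =
      ∀ F → IsFacet C F →
      Σ (Vector (Pred ∣ V ∣ 0ℓ) n) λ ρ →
        AreTheExtremalRaysIn C F ρ × LinearlyIndependentRays ρ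

  module _ (V : VectorSpace) where
    private
      module V = Module V
      open LeftModuleMorphisms V.rawLeftModule (TensorUnit.rawLeftModule {R = rawRing})
      open RingProperties ring using (-‿distribʳ-*; -0#≈0#)
      open AbelianGroupProperties ℝ.+-abelianGroup using (⁻¹-∙-comm)
      open CommutativeSemigroupProperties ℝ.+-commutativeSemigroup using (interchange)
      open CommutativeSemigroupProperties ℝ.*-commutativeSemigroup using (x∙yz≈y∙xz)

    LinearForm : Set
    LinearForm = Σ (V.Carrierᴹ → ℝ.Carrier) IsLeftModuleHomomorphism

    private
      isLinear : (f : V.Carrierᴹ → ℝ.Carrier) →
                 (∀ {x y} → x V.≈ᴹ y → f x ≈ f y) →
                 (∀ x y → f (x V.+ᴹ y) ≈ f x + f y) →
                 (∀ a x → f (a V.*ₗ x) ≈ a * f x) →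
                 IsLeftModuleHomomorphism f
      isLinear f cong +-homo *-homo = record
        { +ᴹ-isGroupHomomorphism = record
          { isMonoidHomomorphism = record
            { isMagmaHomomorphism = record
              { isRelHomomorphism = record { cong = cong }
              ; homo = +-homo }
            ; ε-homo = 0-homo }
          ; ⁻¹-homo = neg-homo }
        ; *ₗ-homo = *-homo }
        where
        0-homo : f V.0ᴹ ≈ 0#
        0-homo = ℝ.trans (cong (V.≈ᴹ-sym (V.*ₗ-zeroˡ V.0ᴹ)))
                         (ℝ.trans (*-homo 0# V.0ᴹ) (ℝ.zeroˡ _))
        open AbelianGroupProperties ℝ.+-abelianGroup using (inverseˡ-unique)
        neg-homo : ∀ x → f (V.-ᴹ x) ≈ - f x
        neg-homo x = inverseˡ-unique _ _
          (ℝ.trans (ℝ.sym (+-homo (V.-ᴹ x) x))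
                   (ℝ.trans (cong (V.-ᴹ‿inverseˡ x)) 0-homo))

    Dual : VectorSpace
    Dual = record
      { Carrierᴹ = LinearForm
      ; _≈ᴹ_     = λ α β → ∀ x → proj₁ α x ≈ proj₁ β x
      ; _+ᴹ_     = add
      ; _*ₗ_     = scale
      ; _*ᵣ_     = flip scale
      ; 0ᴹ       = zeroForm
      ; -ᴹ_      = negate
      ; isModule = IsModuleFromLeft.isModule {commutativeRing = commutativeRing} record
        { isLeftModule = record
          { isLeftSemimodule = record
            { +ᴹ-isCommutativeMonoid = record
              { isMonoid = record
                { isSemigroup = record
                  { isMagma = record
                    { isEquivalence = record
                      { refl  = λ _ → ℝ.refl
                      ; sym   = λ p x → ℝ.sym (p x)
                      ; trans = λ p q x → ℝ.trans (p x) (q x) }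
                    ; ∙-cong = λ p q x → ℝ.+-cong (p x) (q x) }
                  ; assoc = λ _ _ _ _ → ℝ.+-assoc _ _ _ }
                ; identity = (λ _ _ → ℝ.+-identityˡ _) , (λ _ _ → ℝ.+-identityʳ _) }
              ; comm = λ _ _ _ → ℝ.+-comm _ _ }
            ; isPreleftSemimodule = record
              { *ₗ-cong      = λ p q x → ℝ.*-cong p (q x)
              ; *ₗ-zeroˡ     = λ _ _ → ℝ.zeroˡ _
              ; *ₗ-distribʳ  = λ _ _ _ _ → ℝ.distribʳ _ _ _
              ; *ₗ-identityˡ = λ _ _ → ℝ.*-identityˡ _
              ; *ₗ-assoc     = λ _ _ _ _ → ℝ.*-assoc _ _ _
              ; *ₗ-zeroʳ     = λ _ _ → ℝ.zeroʳ _
              ; *ₗ-distribˡ  = λ _ _ _ _ → ℝ.distribˡ _ _ _ } }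
          ; -ᴹ‿cong    = λ p x → ℝ.-‿cong (p x)
          ; -ᴹ‿inverse = (λ _ _ → ℝ.-‿inverseˡ _) , (λ _ _ → ℝ.-‿inverseʳ _) } } }
      where
      open IsLeftModuleHomomorphism

      add : LinearForm → LinearForm → LinearForm
      add (f , hf) (g , hg) = (λ x → f x + g x) , isLinear _
        (λ p → ℝ.+-cong (⟦⟧-cong hf p) (⟦⟧-cong hg p))
        (λ x y → ℝ.trans (ℝ.+-cong (+ᴹ-homo hf x y) (+ᴹ-homo hg x y))
                         (interchange _ _ _ _))
        (λ a x → ℝ.trans (ℝ.+-cong (*ₗ-homo hf a x) (*ₗ-homo hg a x))
                         (ℝ.sym (ℝ.distribˡ _ _ _)))

      scale : ℝ.Carrier → LinearForm → LinearForm
      scale a (f , hf) = (λ x → a * f x) , isLinear _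
        (λ p → ℝ.*-congˡ (⟦⟧-cong hf p))
        (λ x y → ℝ.trans (ℝ.*-congˡ (+ᴹ-homo hf x y)) (ℝ.distribˡ _ _ _))
        (λ b x → ℝ.trans (ℝ.*-congˡ (*ₗ-homo hf b x)) (x∙yz≈y∙xz _ _ _))

      zeroForm : LinearForm
      zeroForm = (λ _ → 0#) , isLinear _
        (λ _ → ℝ.refl)
        (λ _ _ → ℝ.sym (ℝ.+-identityˡ 0#))
        (λ a _ → ℝ.sym (ℝ.zeroʳ a))

      negate : LinearForm → LinearForm
      negate (f , hf) = (λ x → - f x) , isLinear _
        (λ p → ℝ.-‿cong (⟦⟧-cong hf p))
        (λ x y → ℝ.trans (ℝ.-‿cong (+ᴹ-homo hf x y)) (ℝ.sym (⁻¹-∙-comm _ _)))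
        (λ a x → ℝ.trans (ℝ.-‿cong (*ₗ-homo hf a x)) (-‿distribʳ-* _ _))

    Annihilator : Pred V.Carrierᴹ 0ℓ → Pred LinearForm 0ℓ
    Annihilator L α = ∀ x → x ∈ L → proj₁ α x ≈ 0#

  -- V^{⊗ m}, presented by generators and relations: formal expressions in the
  -- pure tensors v₀ ⊗ ⋯ ⊗ vₘ₋₁, modulo the vector space axioms and
  -- multilinearity in each slot.
  module _ (V : VectorSpace) (m : ℕ) where
    private module V = Module V

    infixl 6 _⊕_
    infixr 7 _⊙_
    data Tensor : Set where
      𝟘    : Tensor
      _⊕_  : Tensor → Tensor → Tensor
      _⊙_  : ℝ.Carrier → Tensor → Tensor
      pure : Vector ∣ V ∣ m → Tensor

    infix 4 _≋_
    data _≋_ : Rel Tensor 0ℓ where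
      ≋-refl       : ∀ {s} → s ≋ s
      ≋-sym        : ∀ {s t} → s ≋ t → t ≋ s
      ≋-trans      : ∀ {s t u} → s ≋ t → t ≋ u → s ≋ u
      ⊕-cong       : ∀ {s s′ t t′} → s ≋ s′ → t ≋ t′ → s ⊕ t ≋ s′ ⊕ t′
      ⊕-assoc      : ∀ s t u → (s ⊕ t) ⊕ u ≋ s ⊕ (t ⊕ u)
      ⊕-comm       : ∀ s t → s ⊕ t ≋ t ⊕ s
      ⊕-identityˡ  : ∀ t → 𝟘 ⊕ t ≋ t
      ⊙-cong       : ∀ {a b s t} → a ≈ b → s ≋ t → a ⊙ s ≋ b ⊙ t
      ⊙-zeroˡ      : ∀ t → 0# ⊙ t ≋ 𝟘
      ⊙-identityˡ  : ∀ t → 1# ⊙ t ≋ t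
      ⊙-assoc      : ∀ a b t → (a * b) ⊙ t ≋ a ⊙ b ⊙ t
      ⊙-distribˡ   : ∀ a s t → a ⊙ (s ⊕ t) ≋ a ⊙ s ⊕ a ⊙ t
      ⊙-distribʳ   : ∀ t a b → (a + b) ⊙ t ≋ a ⊙ t ⊕ b ⊙ t
      pure-cong    : ∀ {v w} → (∀ i → v i V.≈ᴹ w i) → pure v ≋ pure w
      pure-+       : ∀ v i x y → pure (updateAt v i (const (x V.+ᴹ y))) ≋
                       pure (updateAt v i (const x)) ⊕ pure (updateAt v i (const y))
      pure-*       : ∀ v i a x → pure (updateAt v i (const (a V.*ₗ x))) ≋
                       a ⊙ pure (updateAt v i (const x))

    private
      ⊙-zeroʳ : ∀ a → a ⊙ 𝟘 ≋ 𝟘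
      ⊙-zeroʳ a = ≋-trans (⊙-cong ℝ.refl (≋-sym (⊙-zeroˡ 𝟘)))
        (≋-trans (≋-sym (⊙-assoc a 0# 𝟘))
        (≋-trans (⊙-cong (ℝ.zeroʳ a) ≋-refl) (⊙-zeroˡ 𝟘)))

      ⊕-inverseʳ : ∀ t → t ⊕ (- 1#) ⊙ t ≋ 𝟘
      ⊕-inverseʳ t = ≋-trans (⊕-cong (≋-sym (⊙-identityˡ t)) ≋-refl)
        (≋-trans (≋-sym (⊙-distribʳ t 1# (- 1#)))
        (≋-trans (⊙-cong (ℝ.-‿inverseʳ 1#) ≋-refl) (⊙-zeroˡ t)))

    TensorPower : VectorSpace
    TensorPower = record
      { Carrierᴹ = Tensor
      ; _≈ᴹ_     = _≋_
      ; _+ᴹ_     = _⊕_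
      ; _*ₗ_     = _⊙_
      ; _*ᵣ_     = flip _⊙_
      ; 0ᴹ       = 𝟘
      ; -ᴹ_      = (- 1#) ⊙_
      ; isModule = IsModuleFromLeft.isModule {commutativeRing = commutativeRing} record
        { isLeftModule = record
          { isLeftSemimodule = record
            { +ᴹ-isCommutativeMonoid = record
              { isMonoid = record
                { isSemigroup = record
                  { isMagma = record
                    { isEquivalence = record
                      { refl = ≋-refl ; sym = ≋-sym ; trans = ≋-trans }
                    ; ∙-cong = ⊕-cong }
                  ; assoc = ⊕-assoc }
                ; identity = ⊕-identityˡ ,
                             λ t → ≋-trans (⊕-comm t 𝟘) (⊕-identityˡ t) }
              ; comm = ⊕-comm }
            ; isPreleftSemimodule = record
              { *ₗ-cong      = ⊙-cong
              ; *ₗ-zeroˡ     = ⊙-zeroˡ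
              ; *ₗ-distribʳ  = ⊙-distribʳ
              ; *ₗ-identityˡ = ⊙-identityˡ
              ; *ₗ-assoc     = ⊙-assoc
              ; *ₗ-zeroʳ     = ⊙-zeroʳ
              ; *ₗ-distribˡ  = ⊙-distribˡ } }
          ; -ᴹ‿cong    = ⊙-cong ℝ.refl
          ; -ᴹ‿inverse = (λ t → ≋-trans (⊕-comm _ t) (⊕-inverseʳ t)) , ⊕-inverseʳ } } }

    permute : Permutation′ m → Tensor → Tensor
    permute π 𝟘        = 𝟘
    permute π (s ⊕ t)  = permute π s ⊕ permute π t
    permute π (a ⊙ t)  = a ⊙ permute π t
    permute π (pure v) = pure (v ∘ (π ⟨$⟩ʳ_))

    IsSymmetric : Pred Tensor 0ℓ
    IsSymmetric t = ∀ π → permute π t ≋ t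

    -- The subspace SᵐV of V^{⊗ m}, as a vector space in its own right.
    SymmetricPower : VectorSpace
    SymmetricPower = record
      { Carrierᴹ = ∃ IsSymmetric
      ; _≈ᴹ_     = λ s t → proj₁ s ≋ proj₁ t
      ; _+ᴹ_     = λ (s , p) (t , q) → s ⊕ t , λ π → ⊕-cong (p π) (q π)
      ; _*ₗ_     = scale
      ; _*ᵣ_     = flip scale
      ; 0ᴹ       = 𝟘 , λ _ → ≋-refl
      ; -ᴹ_      = scale (- 1#)
      ; isModule = IsModuleFromLeft.isModule {commutativeRing = commutativeRing} record
        { isLeftModule = record
          { isLeftSemimodule = record
            { +ᴹ-isCommutativeMonoid = record
              { isMonoid = record
                { isSemigroup = record
                  { isMagma = record
                    { isEquivalence = record
                      { refl = ≋-refl ; sym = ≋-sym ; trans = ≋-trans }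
                    ; ∙-cong = ⊕-cong }
                  ; assoc = λ _ _ _ → ⊕-assoc _ _ _ }
                ; identity = (λ _ → ⊕-identityˡ _) ,
                             λ _ → ≋-trans (⊕-comm _ 𝟘) (⊕-identityˡ _) }
              ; comm = λ _ _ → ⊕-comm _ _ }
            ; isPreleftSemimodule = record
              { *ₗ-cong      = ⊙-cong
              ; *ₗ-zeroˡ     = λ _ → ⊙-zeroˡ _
              ; *ₗ-distribʳ  = λ _ _ _ → ⊙-distribʳ _ _ _
              ; *ₗ-identityˡ = λ _ → ⊙-identityˡ _
              ; *ₗ-assoc     = λ _ _ _ → ⊙-assoc _ _ _
              ; *ₗ-zeroʳ     = λ a → ⊙-zeroʳ a
              ; *ₗ-distribˡ  = λ _ _ _ → ⊙-distribˡ _ _ _ } }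
          ; -ᴹ‿cong    = ⊙-cong ℝ.refl
          ; -ᴹ‿inverse = (λ _ → ≋-trans (⊕-comm _ _) (⊕-inverseʳ _)) ,
                         λ _ → ⊕-inverseʳ _ } } }
      where
      scale : ℝ.Carrier → ∃ IsSymmetric → ∃ IsSymmetric
      scale a (t , p) = a ⊙ t , λ π → ⊙-cong ℝ.refl (p π)

  module Veronese (W : VectorSpace) (m : ℕ) where

    W* : VectorSpace
    W* = Dual W

    SᵐW* : VectorSpace
    SᵐW* = SymmetricPower W* m

    -- The Veronese factorization structure SᵐW* ↪ (W*)^{⊗ m}.
    φ : ∣ SᵐW* ∣ → ∣ TensorPower W* m ∣
    φ = proj₁

    -- (ℓ⁰)^{⊗ m}, the multiples of α ⊗ ⋯ ⊗ α for 0 ≠ α ∈ ℓ⁰.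
    AnnihilatorPower : ℙ W → Pred ∣ TensorPower W* m ∣ 0ℓ
    AnnihilatorPower (ℓ , _) x =
      ∃[ α ] (α ∈ Annihilator W ℓ × ¬ (α W*.≈ᴹ W*.0ᴹ) ×
              ∃[ c ] x T.≈ᴹ c T.*ₗ pure (λ _ → α))
      where
      module W* = Module W*
      module T  = Module (TensorPower W* m)

    ψ : ℙ W → Pred ∣ SᵐW* ∣ 0ℓ
    ψ ℓ x = φ x ∈ AnnihilatorPower ℓ

{-# OPTIONS --safe #-}
module Submission where

-- A pointed polyhedral cone is generated by its extremal rays, which here are
-- multiples of powers α ⊗ ⋯ ⊗ α.  The powers span a space of dimension m + 1,
-- and at most m + 1 powers of pairwise non-proportional forms are linearly
-- independent: evaluation at a vector w₁ ⊗ ⋯ ⊗ wₘ, with the wₖ taken in the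
-- kernels of the other forms, isolates one of them.  So σ∨ has dimension m + 1
-- and a facet spans dimension m; fewer than m rays would not span it, and m + 1
-- rays in it would be independent.

open import Defs
open import Level using (0ℓ)
open import Algebra.Bundles using (CommutativeMonoid; Semiring)
import Algebra.Definitions.RawSemiring as RawSemiringDefinitions
open import Algebra.Module.Bundles using (Module)
import Algebra.Module.Construct.TensorUnit as TensorUnit
open import Algebra.Module.Morphism.Structures using (module LeftModuleMorphisms)
import Algebra.Module.Properties as ModuleProperties
import Algebra.Properties.CommutativeMonoid.Sum as MonoidSum
import Algebra.Properties.CommutativeSemigroup as CommutativeSemigroupProperties
import Algebra.Properties.Ring as RingProperties
import Algebra.Properties.Semiring.Sum as SemiringSum
open import Data.Empty using (⊥-elim)
open import Data.Fin.Base as Fin using (Fin; zero; suc; punchIn; punchOut; toℕ; inject≤)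
open import Data.Fin.Properties as Fin using (any?; punchIn-punchOut)
open import Data.Nat.Base using (ℕ; zero; suc)
open import Data.Nat.Base as ℕ using ()
open import Data.Nat.Properties as ℕ using ()
open import Data.Product.Base using (Σ; ∃; ∃-syntax; _×_; _,_; proj₁; proj₂)
open import Data.Sum.Base using (_⊎_; inj₁; inj₂)
open import Data.Unit.Base using (tt)
open import Data.Vec.Functional using (Vector; updateAt; removeAt; insertAt; _∷_; tail)
open import Data.Vec.Functional.Properties
  using (insertAt-lookup; insertAt-punchIn; updateAt-updates; updateAt-minimal)
open import Function.Base using (_∘_; const; id)
open import Relation.Binary.Definitions using (tri<; tri≈; tri>)
open import Relation.Binary.PropositionalEquality.Core as ≡ using (_≡_; _≢_)
open import Relation.Binary.Structures using (IsStrictTotalOrder)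
import Relation.Binary.Reasoning.Setoid as SetoidReasoning
open import Relation.Nullary.Decidable.Core using (Dec; yes; no; ¬?)
open import Relation.Nullary.Negation using (¬_; contradiction)
open import Relation.Unary using (Pred; Decidable; _∈_; _⊆_; _≐_; U)

-- Faces are arbitrary predicates and no coordinates on `SᵐW*` are given, so a face is reached only
-- through the generators of the cone: excluded middle decides which of them it contains. Separation
-- theorems and duality of cones are avoided. Once no generator is a nonnegative combination of the
-- others, pointedness alone forces each generator to span an extremal ray.
--
-- Tensors are formal expressions modulo a generated relation, so a linear relation between them is
-- contradicted by an invariant of that relation; this is why independence goes through evaluation.
-- No basis of `SᵐW*` is built either. The upper bound on its dimension comes from vectors of the
-- ambient tensor power, the lower bound from powers inside `SᵐW*`, and `φ` carries independence
-- between the two spaces.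

-- Arithmetic of the ordered field and excluded middle.

module OrderedField (ℝ : CompleteOrderedField) where
  open CompleteOrderedField ℝ hiding (zero) public
  open IsStrictTotalOrder isStrictTotalOrder public
    using (_≟_; compare; irrefl; <-respʳ-≈; <-respˡ-≈) renaming (trans to <-trans)
  open RingProperties ring public
    using (-‿distribˡ-*; -‿distribʳ-*)
  open SetoidReasoning setoid

  ≤-resp-≈ : ∀ {x y z} → y ≈ z → x ≤ y → x ≤ z
  ≤-resp-≈ y≈z (inj₁ x<y) = inj₁ (<-respʳ-≈ y≈z x<y)
  ≤-resp-≈ y≈z (inj₂ x≈y) = inj₂ (trans x≈y y≈z)

  0≤1 : 0# ≤ 1#
  0≤1 = inj₁ 0<1

  0≤0 : 0# ≤ 0#
  0≤0 = inj₂ refl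

  1≉0 : ¬ (1# ≈ 0#)
  1≉0 1≈0 = irrefl (sym 1≈0) 0<1

  1≤⇒0< : ∀ {x} → 1# ≤ x → 0# < x
  1≤⇒0< (inj₁ 1<x) = <-trans 0<1 1<x
  1≤⇒0< (inj₂ 1≈x) = <-respʳ-≈ 1≈x 0<1

  -- The supremum of {0} ∪ {1 ∣ A} is positive exactly when A holds.
  excludedMiddle : (A : Set) → Dec A
  excludedMiddle A with supremum P (0# , inj₁ refl) (1# , ≤1)
    where
    P : Pred Carrier 0ℓ
    P x = x ≈ 0# ⊎ (x ≈ 1# × A)
    ≤1 : IsUpperBound P 1#
    ≤1 x (inj₁ x≈0) = inj₁ (<-respˡ-≈ (sym x≈0) 0<1)
    ≤1 x (inj₂ (x≈1 , _)) = inj₂ x≈1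
  ... | s , ≤s , approached with compare 0# s
  ...   | tri≈ ¬0<s _ _ = no λ a → ¬0<s (1≤⇒0< (≤s 1# (inj₂ (refl , a))))
  ...   | tri> ¬0<s _ _ = no λ a → ¬0<s (1≤⇒0< (≤s 1# (inj₂ (refl , a))))
  ...   | tri< 0<s _ _ with approached 0# 0<s
  ...     | x , inj₁ x≈0 , 0<x = contradiction 0<x (irrefl (sym x≈0))
  ...     | x , inj₂ (_ , a) , _ = yes a

  +-positive : ∀ {x y} → 0# < x → 0# < y → 0# < x + y
  +-positive {x} 0<x 0<y = <-trans 0<x (<-respˡ-≈ (+-identityʳ x) (+-monoʳ-< x 0<y))

  +-nonneg : ∀ {x y} → 0# ≤ x → 0# ≤ y → 0# ≤ x + y
  +-nonneg (inj₁ 0<x) (inj₁ 0<y) = inj₁ (+-positive 0<x 0<y)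
  +-nonneg {x} {y} 0≤x (inj₂ 0≈y) = ≤-resp-≈ (trans (sym (+-identityʳ x)) (+-congˡ 0≈y)) 0≤x
  +-nonneg {x} {y} (inj₂ 0≈x) 0≤y = ≤-resp-≈ (trans (sym (+-identityˡ y)) (+-congʳ 0≈x)) 0≤y

  *-nonneg : ∀ {x y} → 0# ≤ x → 0# ≤ y → 0# ≤ x * y
  *-nonneg (inj₁ 0<x) (inj₁ 0<y) = inj₁ (*-pos 0<x 0<y)
  *-nonneg {x} 0≤x (inj₂ 0≈y) = inj₂ (trans (sym (zeroʳ x)) (*-congˡ 0≈y))
  *-nonneg {_} {y} (inj₂ 0≈x) 0≤y = inj₂ (trans (sym (zeroˡ y)) (*-congʳ 0≈x))

  nonneg-total : ∀ x → 0# ≤ x ⊎ 0# ≤ - x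
  nonneg-total x with compare 0# x
  ... | tri< 0<x _ _ = inj₁ (inj₁ 0<x)
  ... | tri≈ _ 0≈x _ = inj₁ (inj₂ 0≈x)
  ... | tri> _ _ x<0 = inj₂ (inj₁ (<-respˡ-≈ (-‿inverseˡ x)
                         (<-respʳ-≈ (+-identityʳ (- x)) (+-monoʳ-< (- x) x<0))))

  nonneg-sum-zero : ∀ {x y} → 0# ≤ x → 0# ≤ y → x + y ≈ 0# → x ≈ 0#
  nonneg-sum-zero (inj₂ 0≈x) _ _ = sym 0≈x
  nonneg-sum-zero (inj₁ 0<x) (inj₁ 0<y) x+y≈0 =
    contradiction (+-positive 0<x 0<y) (irrefl (sym x+y≈0))
  nonneg-sum-zero {x} (inj₁ 0<x) (inj₂ 0≈y) x+y≈0 =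
    trans (sym (+-identityʳ x)) (trans (+-congˡ 0≈y) x+y≈0)

  nonneg-antisym : ∀ {x} → 0# ≤ x → 0# ≤ - x → x ≈ 0#
  nonneg-antisym 0≤x 0≤-x = nonneg-sum-zero 0≤x 0≤-x (-‿inverseʳ _)

  -- Were `- y` nonnegative, so would be `x * - y`, which is `- 1#`; together with `0≤1` this gives
  -- `1# ≈ 0#`.
  inverse-nonneg : ∀ {x y} → 0# ≤ x → x * y ≈ 1# → 0# ≤ y
  inverse-nonneg {x} {y} 0≤x xy≈1 with nonneg-total y
  ... | inj₁ 0≤y = 0≤y
  ... | inj₂ 0≤-y = contradiction (nonneg-antisym 0≤1 0≤-1) 1≉0
    where
    0≤-1 : 0# ≤ - 1#
    0≤-1 = ≤-resp-≈ (trans (sym (-‿distribʳ-* x y)) (-‿cong xy≈1)) (*-nonneg 0≤x 0≤-y)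

  *-nonzero : ∀ {x y} → ¬ (x ≈ 0#) → ¬ (y ≈ 0#) → ¬ (x * y ≈ 0#)
  *-nonzero {x} {y} x≉0 y≉0 xy≈0 with inverse x x≉0
  ... | x⁻¹ , xx⁻¹≈1 = y≉0 (begin
    y              ≈⟨ *-identityˡ y ⟨
    1# * y         ≈⟨ *-congʳ (trans (*-comm x⁻¹ x) xx⁻¹≈1) ⟨
    (x⁻¹ * x) * y  ≈⟨ *-assoc x⁻¹ x y ⟩
    x⁻¹ * (x * y)  ≈⟨ *-congˡ xy≈0 ⟩
    x⁻¹ * 0#       ≈⟨ zeroʳ x⁻¹ ⟩
    0#             ∎)

  x-y≈0⇒x≈y : ∀ {x y} → x + - y ≈ 0# → x ≈ y
  x-y≈0⇒x≈y = RingProperties.x∙y⁻¹≈ε⇒x≈y ring _ _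

-- Homogeneous linear systems.

module HomogeneousSystem (ℝ : CompleteOrderedField) where
  open OrderedField ℝ
  open SemiringSum semiring
  open SetoidReasoning setoid

  sum-zero : ∀ {n} {t : Vector Carrier n} → (∀ i → t i ≈ 0#) → sum t ≈ 0#
  sum-zero {n} t≈0 = trans (sum-cong-≋ t≈0) (sum-replicate-zero n)

  -- Gaussian elimination, where `a i k` is the coefficient of the unknown `i` in the equation `k`.
  -- Each round removes one unknown and one equation, which preserves the surplus of unknowns.
  nontrivialSolution : ∀ {p q} → q ℕ.< p → (a : Fin p → Fin q → Carrier) →
    Σ (Vector Carrier p) λ c → (∃[ i ] ¬ (c i ≈ 0#)) × (∀ k → sum (λ i → c i * a i k) ≈ 0#)
  nontrivialSolution {suc p} {zero} _ a = const 1# , (zero , 1≉0) , λ ()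
  nontrivialSolution {suc p} {suc q} (ℕ.s≤s q<p) a with any? (λ i → ¬? (a i zero ≟ 0#))
  -- Equation `zero` is vacuous here; the unknown `zero` is sacrificed along with it to keep the
  -- counts in step.
  ... | no ¬pivot = 0# ∷ c , (suc i , ci≉0) , solves
    where
    sol = nontrivialSolution q<p (λ i k → a (suc i) (suc k))
    c = proj₁ sol
    i = proj₁ (proj₁ (proj₂ sol))
    ci≉0 = proj₂ (proj₁ (proj₂ sol))
    column₀ : ∀ i → a i zero ≈ 0#
    column₀ i with a i zero ≟ 0#
    ... | yes p = p
    ... | no ¬p = contradiction (i , ¬p) ¬pivot
    solves : ∀ k → sum (λ i → (0# ∷ c) i * a i k) ≈ 0#
    solves zero = sum-zero (λ i → trans (*-congˡ (column₀ i)) (zeroʳ ((0# ∷ c) i)))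
    solves (suc k) = trans (+-cong (zeroˡ _) (proj₂ (proj₂ sol) k)) (+-identityˡ 0#)
  ... | yes (r , pivot≉0) = c , (punchIn r i , ci≉0) , solves
    where
    u = proj₁ (inverse (a r zero) pivot≉0)
    au≈1 = proj₂ (inverse (a r zero) pivot≉0)
    m : Fin p → Carrier
    m j = a (punchIn r j) zero * u
    sol = nontrivialSolution q<p (λ j k → a (punchIn r j) (suc k) + - (m j * a r (suc k)))
    d = proj₁ sol
    i = proj₁ (proj₁ (proj₂ sol))
    -- The value of the pivot unknown that makes equation `zero` hold, since `m j` is the ratio of
    -- the `j`-th remaining coefficient to the pivot.
    s = - sum (λ j → d j * m j)
    c : Vector Carrier (suc p)
    c = insertAt d r s
    c-punchIn : ∀ j → c (punchIn r j) ≈ d j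
    c-punchIn j = reflexive (insertAt-punchIn d r s j)
    ci≉0 : ¬ (c (punchIn r i) ≈ 0#)
    ci≉0 ci≈0 = proj₂ (proj₁ (proj₂ sol)) (trans (sym (c-punchIn i)) ci≈0)
    combine : ∀ k → sum (λ i → c i * a i k) ≈
              sum (λ j → d j * (a (punchIn r j) k + - (m j * a r k)))
    combine k = begin
      sum (λ i → c i * a i k)
        ≈⟨ sum-remove {i = r} (λ i → c i * a i k) ⟩
      c r * a r k + sum (λ j → c (punchIn r j) * a (punchIn r j) k)
        ≈⟨ +-cong (*-congʳ (reflexive (insertAt-lookup d r s)))
                  (sum-cong-≋ (λ j → *-congʳ (c-punchIn j))) ⟩
      s * a r k + sum (λ j → d j * a (punchIn r j) k)
        ≈⟨ +-congʳ eliminated ⟩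
      sum (λ j → d j * - (m j * a r k)) + sum (λ j → d j * a (punchIn r j) k)
        ≈⟨ +-comm _ _ ⟩
      sum (λ j → d j * a (punchIn r j) k) + sum (λ j → d j * - (m j * a r k))
        ≈⟨ ∑-distrib-+ _ (λ j → d j * - (m j * a r k)) ⟨
      sum (λ j → d j * a (punchIn r j) k + d j * - (m j * a r k))
        ≈⟨ sum-cong-≋ (λ j → distribˡ (d j) (a (punchIn r j) k) (- (m j * a r k))) ⟨
      sum (λ j → d j * (a (punchIn r j) k + - (m j * a r k))) ∎
      where
      eliminated : s * a r k ≈ sum (λ j → d j * - (m j * a r k))
      eliminated = begin
        - sum (λ j → d j * m j) * a r k   ≈⟨ -‿distribˡ-* _ _ ⟨
        - (sum (λ j → d j * m j) * a r k) ≈⟨ -‿distribʳ-* _ _ ⟩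
        sum (λ j → d j * m j) * - a r k   ≈⟨ *-distribʳ-sum _ (λ j → d j * m j) ⟩
        sum (λ j → d j * m j * - a r k)
          ≈⟨ sum-cong-≋ (λ j → trans (*-assoc (d j) (m j) _) (*-congˡ (sym (-‿distribʳ-* (m j) _)))) ⟩
        sum (λ j → d j * - (m j * a r k)) ∎
    m-eliminates : ∀ j → a (punchIn r j) zero + - (m j * a r zero) ≈ 0#
    m-eliminates j = trans (+-congˡ (-‿cong (begin
      a (punchIn r j) zero * u * a r zero   ≈⟨ *-assoc _ _ _ ⟩
      a (punchIn r j) zero * (u * a r zero) ≈⟨ *-congˡ (trans (*-comm _ _) au≈1) ⟩
      a (punchIn r j) zero * 1#             ≈⟨ *-identityʳ _ ⟩
      a (punchIn r j) zero                  ∎))) (-‿inverseʳ _)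
    solves : ∀ k → sum (λ i → c i * a i k) ≈ 0#
    solves zero = trans (combine zero)
      (sum-zero (λ j → trans (*-congˡ (m-eliminates j)) (zeroʳ (d j))))
    solves (suc k) = trans (combine (suc k)) (proj₂ (proj₂ sol) k)

-- Linear combinations, spans and the exchange inequality.

module LinearAlgebra (ℝ : CompleteOrderedField) (V : RealGeometry.VectorSpace ℝ) where
  open OrderedField ℝ
  open HomogeneousSystem ℝ using (nontrivialSolution)
  open RealGeometry ℝ hiding (module ℝ)
  open Module V
  open MonoidSum +ᴹ-commutativeMonoid using ()
    renaming (sum-cong-≋ to sumᴹ-cong; ∑-distrib-+ to ∑ᴹ-distrib-+)
  open SemiringSum semiring using (sum)
  open CommutativeSemigroupProperties (CommutativeMonoid.commutativeSemigroup +ᴹ-commutativeMonoid) using (x∙yz≈y∙xz)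
  open ModuleProperties V using (x≈0⇒x*y≈0; y≈0⇒x*y≈0)
  open SetoidReasoning ≈ᴹ-setoid

  lc : ∀ {n} → Vector Carrier n → Vector Carrierᴹ n → Carrierᴹ
  lc = linearCombination V

  lc-cong : ∀ {n} {c d : Vector Carrier n} {v w : Vector Carrierᴹ n} →
            (∀ i → c i ≈ d i) → (∀ i → v i ≈ᴹ w i) → lc c v ≈ᴹ lc d w
  lc-cong c≈d v≈w = sumᴹ-cong (λ i → *ₗ-cong (c≈d i) (v≈w i))

  lc-+ : ∀ {n} (c d : Vector Carrier n) (v : Vector Carrierᴹ n) →
         lc (λ i → c i + d i) v ≈ᴹ lc c v +ᴹ lc d v
  lc-+ c d v = ≈ᴹ-trans (sumᴹ-cong (λ i → *ₗ-distribʳ (v i) (c i) (d i)))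
                        (∑ᴹ-distrib-+ (λ i → c i *ₗ v i) (λ i → d i *ₗ v i))

  lc-* : ∀ {n} a (c : Vector Carrier n) (v : Vector Carrierᴹ n) →
         lc (λ i → a * c i) v ≈ᴹ a *ₗ lc c v
  lc-* {zero}  a c v = ≈ᴹ-sym (*ₗ-zeroʳ a)
  lc-* {suc n} a c v = ≈ᴹ-trans
    (+ᴹ-cong (*ₗ-assoc a (c zero) (v zero)) (lc-* a (tail c) (tail v)))
    (≈ᴹ-sym (*ₗ-distribˡ a _ _))

  lc-zero : ∀ {n} {c : Vector Carrier n} {v : Vector Carrierᴹ n} →
            (∀ i → c i ≈ 0#) → lc c v ≈ᴹ 0ᴹ
  lc-zero {zero}  c≈0 = ≈ᴹ-refl
  lc-zero {suc n} c≈0 =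
    ≈ᴹ-trans (+ᴹ-cong (x≈0⇒x*y≈0 (c≈0 zero)) (lc-zero (c≈0 ∘ suc))) (+ᴹ-identityˡ 0ᴹ)

  lc-lc : ∀ {p q} (c : Vector Carrier p) (a : Fin p → Vector Carrier q) (b : Vector Carrierᴹ q) →
          lc c (λ i → lc (a i) b) ≈ᴹ lc (λ k → sum (λ i → c i * a i k)) b
  lc-lc {zero}  c a b = ≈ᴹ-sym (lc-zero {v = b} (λ _ → refl))
  lc-lc {suc p} c a b = begin
    c zero *ₗ lc (a zero) b +ᴹ lc (tail c) (λ i → lc (a (suc i)) b)
      ≈⟨ +ᴹ-cong (≈ᴹ-sym (lc-* (c zero) (a zero) b)) (lc-lc (tail c) (tail a) b) ⟩
    lc (λ k → c zero * a zero k) b +ᴹ lc (λ k → sum (λ i → c (suc i) * a (suc i) k)) b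
      ≈⟨ lc-+ _ (λ k → sum (λ i → c (suc i) * a (suc i) k)) b ⟨
    lc (λ k → sum (λ i → c i * a i k)) b ∎

  unit : ∀ {n} → Fin n → Vector Carrier n
  unit zero    = 1# ∷ const 0#
  unit (suc i) = 0# ∷ unit i

  unit-nonneg : ∀ {n} (i j : Fin n) → 0# ≤ unit i j
  unit-nonneg zero    zero    = 0≤1
  unit-nonneg zero    (suc j) = 0≤0
  unit-nonneg (suc i) zero    = 0≤0
  unit-nonneg (suc i) (suc j) = unit-nonneg i j

  unit-off-diagonal : ∀ {n} {i j : Fin n} → i ≢ j → unit i j ≈ 0#
  unit-off-diagonal {i = zero}  {zero}  i≢j = contradiction ≡.refl i≢j
  unit-off-diagonal {i = zero}  {suc j} i≢j = refl
  unit-off-diagonal {i = suc i} {zero}  i≢j = refl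
  unit-off-diagonal {i = suc i} {suc j} i≢j = unit-off-diagonal (i≢j ∘ ≡.cong suc)

  lc-unit : ∀ {n} (i : Fin n) (v : Vector Carrierᴹ n) → lc (unit i) v ≈ᴹ v i
  lc-unit zero v = ≈ᴹ-trans
    (+ᴹ-cong (*ₗ-identityˡ (v zero)) (lc-zero {v = tail v} (λ _ → refl))) (+ᴹ-identityʳ _)
  lc-unit (suc i) v = ≈ᴹ-trans
    (+ᴹ-cong (*ₗ-zeroˡ (v zero)) (lc-unit i (tail v))) (+ᴹ-identityˡ _)

  -- A term is dropped by annulling its coefficient, so that all combinations remain over one and
  -- the same family.
  zeroAt : ∀ {n} → Fin n → Vector Carrier n → Vector Carrier n
  zeroAt i c = updateAt c i (const 0#)

  zeroAt-nonneg : ∀ {n} (i : Fin n) {c : Vector Carrier n} →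
                  (∀ j → 0# ≤ c j) → ∀ j → 0# ≤ zeroAt i c j
  zeroAt-nonneg zero    0≤c zero    = 0≤0
  zeroAt-nonneg zero    0≤c (suc j) = 0≤c (suc j)
  zeroAt-nonneg (suc i) 0≤c zero    = 0≤c zero
  zeroAt-nonneg (suc i) 0≤c (suc j) = zeroAt-nonneg i (0≤c ∘ suc) j

  -- Used with `d` a sum of two nonnegative vectors and `c` one of the summands: vanishing away from
  -- `i` passes from the sum to the summand.
  zeroAt-zero : ∀ {n} (i : Fin n) {c d : Vector Carrier n} →
                (∀ j → d j ≈ 0# → c j ≈ 0#) → ∀ j → zeroAt i d j ≈ 0# → zeroAt i c j ≈ 0#
  zeroAt-zero zero    d≈0⇒c≈0 zero    _   = refl
  zeroAt-zero zero    d≈0⇒c≈0 (suc j) d≈0 = d≈0⇒c≈0 (suc j) d≈0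
  zeroAt-zero (suc i) d≈0⇒c≈0 zero    d≈0 = d≈0⇒c≈0 zero d≈0
  zeroAt-zero (suc i) d≈0⇒c≈0 (suc j) d≈0 = zeroAt-zero i (d≈0⇒c≈0 ∘ suc) j d≈0

  lc-zeroAt : ∀ {n} (i : Fin n) (c : Vector Carrier n) (v : Vector Carrierᴹ n) →
              lc c v ≈ᴹ c i *ₗ v i +ᴹ lc (zeroAt i c) v
  lc-zeroAt zero c v = +ᴹ-congˡ (≈ᴹ-sym
    (≈ᴹ-trans (+ᴹ-congʳ (*ₗ-zeroˡ (v zero))) (+ᴹ-identityˡ _)))
  lc-zeroAt (suc i) c v = ≈ᴹ-trans (+ᴹ-congˡ (lc-zeroAt i (tail c) (tail v)))
                                   (x∙yz≈y∙xz _ _ _)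

  *ₗ-inverse : ∀ {a b} → a * b ≈ 1# → ∀ x → b *ₗ a *ₗ x ≈ᴹ x
  *ₗ-inverse {a} {b} ab≈1 x = begin
    b *ₗ a *ₗ x   ≈⟨ *ₗ-assoc b a x ⟨
    (b * a) *ₗ x  ≈⟨ *ₗ-congʳ (trans (*-comm b a) ab≈1) ⟩
    1# *ₗ x       ≈⟨ *ₗ-identityˡ x ⟩
    x             ∎

  *ₗ-zero-scalar : ∀ {a x} → ¬ (x ≈ᴹ 0ᴹ) → a *ₗ x ≈ᴹ 0ᴹ → a ≈ 0#
  *ₗ-zero-scalar {a} {x} x≉0 ax≈0 with a ≟ 0#
  ... | yes a≈0 = a≈0
  ... | no a≉0 with inverse a a≉0
  ...   | b , ab≈1 = contradiction (≈ᴹ-trans (≈ᴹ-sym (*ₗ-inverse ab≈1 x)) (y≈0⇒x*y≈0 ax≈0)) x≉0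

  *ₗ-neg-cancel : ∀ a x → a *ₗ x +ᴹ (- a) *ₗ x ≈ᴹ 0ᴹ
  *ₗ-neg-cancel a x = ≈ᴹ-trans (≈ᴹ-sym (*ₗ-distribʳ x a (- a))) (x≈0⇒x*y≈0 (-‿inverseʳ a))

  independent-unique : ∀ {n} {v : Vector Carrierᴹ n} → LinearlyIndependent V v →
                       ∀ c d → lc c v ≈ᴹ lc d v → ∀ i → c i ≈ d i
  independent-unique {v = v} independent c d cv≈dv i =
    x-y≈0⇒x≈y (independent (λ i → c i + - d i) (begin
      lc (λ i → c i + - d i) v               ≈⟨ lc-+ c (λ i → - d i) v ⟩
      lc c v +ᴹ lc (λ i → - d i) v           ≈⟨ +ᴹ-congʳ cv≈dv ⟩
      lc d v +ᴹ lc (λ i → - d i) v           ≈⟨ lc-+ d (λ i → - d i) v ⟨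
      lc (λ i → d i + - d i) v               ≈⟨ lc-zero (λ i → -‿inverseʳ (d i)) ⟩
      0ᴹ ∎) i)

  independent-nonzero : ∀ {n} {v : Vector Carrierᴹ n} → LinearlyIndependent V v →
                        ∀ i → ¬ (v i ≈ᴹ 0ᴹ)
  independent-nonzero {v = v} independent i vi≈0 =
    1≉0 (trans (sym (unit-diagonal i)) (independent (unit i) (≈ᴹ-trans (lc-unit i v) vi≈0) i))
    where
    unit-diagonal : ∀ {n} (i : Fin n) → unit i i ≈ 1#
    unit-diagonal zero    = refl
    unit-diagonal (suc i) = unit-diagonal i

  Combinations : ∀ {n} → Vector Carrierᴹ n → Pred Carrierᴹ 0ℓ
  Combinations v x = ∃[ c ] x ≈ᴹ lc c v

  combinations-isSubspace : ∀ {n} (v : Vector Carrierᴹ n) → IsSubspace V (Combinations v)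
  combinations-isSubspace v = record
    { resp = λ x≈y (c , x≈cv) → c , ≈ᴹ-trans (≈ᴹ-sym x≈y) x≈cv
    ; 0∈   = const 0# , ≈ᴹ-sym (lc-zero {v = v} (λ _ → refl))
    ; +∈   = λ (c , x≈cv) (d , y≈dv) → (λ i → c i + d i) ,
               ≈ᴹ-trans (+ᴹ-cong x≈cv y≈dv) (≈ᴹ-sym (lc-+ c d v))
    ; *∈   = λ a (c , x≈cv) → (λ i → a * c i) ,
               ≈ᴹ-trans (*ₗ-congˡ x≈cv) (≈ᴹ-sym (lc-* a c v))
    }

  generator∈combinations : ∀ {n} (v : Vector Carrierᴹ n) i → v i ∈ Combinations v
  generator∈combinations v i = unit i , ≈ᴹ-sym (lc-unit i v)

  subspace-lc : ∀ {L n} {c : Vector Carrier n} {v : Vector Carrierᴹ n} →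
                IsSubspace V L → (∀ i → v i ∈ L) → lc c v ∈ L
  subspace-lc {n = zero}  L-sub v∈L = IsSubspace.0∈ L-sub
  subspace-lc {n = suc n} L-sub v∈L =
    IsSubspace.+∈ L-sub (IsSubspace.*∈ L-sub _ (v∈L zero)) (subspace-lc L-sub (v∈L ∘ suc))

  span-minimal : ∀ {S L} → IsSubspace V L → S ⊆ L → Span V S ⊆ L
  span-minimal L-sub S⊆L (n , v , c , v∈S , x≈cv) =
    IsSubspace.resp L-sub (≈ᴹ-sym x≈cv) (subspace-lc L-sub (S⊆L ∘ v∈S))

  ⊆span : ∀ {S} → S ⊆ Span V S
  ⊆span {_} {x} x∈S = 1 , const x , const 1# , const x∈S ,
    ≈ᴹ-sym (≈ᴹ-trans (+ᴹ-identityʳ _) (*ₗ-identityˡ x))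

  -- If `p` exceeded `q`, the coordinates of the `v i` would form a system with more unknowns than
  -- equations, and a nontrivial solution is a relation among the `v i`.
  steinitz : ∀ {p q} {v : Vector Carrierᴹ p} {b : Vector Carrierᴹ q} →
             LinearlyIndependent V v → (∀ i → v i ∈ Combinations b) → p ℕ.≤ q
  steinitz {p} {q} {v} {b} independent v∈b with p ℕ.≤? q
  ... | yes p≤q = p≤q
  ... | no p≰q with nontrivialSolution (ℕ.≰⇒> p≰q) (λ i → proj₁ (v∈b i))
  ...   | c , (i , ci≉0) , solves = contradiction (independent c (begin
    lc c v                                            ≈⟨ lc-cong (λ _ → refl) (λ i → proj₂ (v∈b i)) ⟩
    lc c (λ i → lc (proj₁ (v∈b i)) b)                 ≈⟨ lc-lc c (λ i → proj₁ (v∈b i)) b ⟩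
    lc (λ k → sum (λ i → c i * proj₁ (v∈b i) k)) b    ≈⟨ lc-zero solves ⟩
    0ᴹ                                                ∎) i) ci≉0

-- Pointed polyhedral cones: generators, faces and extremal rays.

module Cones (ℝ : CompleteOrderedField) (V : RealGeometry.VectorSpace ℝ) where
  open OrderedField ℝ
  open LinearAlgebra ℝ V
  open RealGeometry ℝ hiding (module ℝ)
  open Module V
  open MonoidSum +ᴹ-commutativeMonoid using (sum-remove; sum-cong-≋)
  open ModuleProperties V using (x≈0⇒x*y≈0; y≈0⇒x*y≈0)
  open SetoidReasoning ≈ᴹ-setoid

  convexCone-lc : ∀ {C n} {c : Vector Carrier n} {v : Vector Carrierᴹ n} → IsConvexCone V C →
                  (∀ i → 0# ≤ c i) → (∀ i → v i ∈ C) → lc c v ∈ C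
  convexCone-lc {n = zero}  C-cone 0≤c v∈C = IsConvexCone.0∈ C-cone
  convexCone-lc {n = suc n} C-cone 0≤c v∈C =
    IsConvexCone.+∈ C-cone (IsConvexCone.*∈ C-cone (0≤c zero) (v∈C zero))
                           (convexCone-lc C-cone (0≤c ∘ suc) (v∈C ∘ suc))

  hull-isConvexCone : ∀ {k} (g : Vector Carrierᴹ k) → IsConvexCone V (ConicalHull V g)
  hull-isConvexCone g = record
    { resp = λ x≈y (c , 0≤c , x≈cg) → c , 0≤c , ≈ᴹ-trans (≈ᴹ-sym x≈y) x≈cg
    ; 0∈   = const 0# , (λ _ → 0≤0) , ≈ᴹ-sym (lc-zero {v = g} (λ _ → refl))
    ; +∈   = λ (c , 0≤c , x≈cg) (d , 0≤d , y≈dg) → (λ i → c i + d i) ,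
               (λ i → +-nonneg (0≤c i) (0≤d i)) ,
               ≈ᴹ-trans (+ᴹ-cong x≈cg y≈dg) (≈ᴹ-sym (lc-+ c d g))
    ; *∈   = λ {a} 0≤a (c , 0≤c , x≈cg) → (λ i → a * c i) , (λ i → *-nonneg 0≤a (0≤c i)) ,
               ≈ᴹ-trans (*ₗ-congˡ x≈cg) (≈ᴹ-sym (lc-* a c g))
    }

  generator∈hull : ∀ {k} (g : Vector Carrierᴹ k) i → g i ∈ ConicalHull V g
  generator∈hull g i = unit i , unit-nonneg i , ≈ᴹ-sym (lc-unit i g)

  hull-minimal : ∀ {k C} {g : Vector Carrierᴹ k} → IsConvexCone V C →
                 (∀ i → g i ∈ C) → ConicalHull V g ⊆ C
  hull-minimal C-cone g∈C (c , 0≤c , x≈cg) =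
    IsConvexCone.resp C-cone (≈ᴹ-sym x≈cg) (convexCone-lc C-cone 0≤c g∈C)

  -- The condition `c i ≈ 0#` says that only the other generators are used, without reindexing them.
  Redundant : ∀ {k} → Vector Carrierᴹ k → Set
  Redundant g = ∃[ i ] ∃[ c ] ((∀ j → 0# ≤ c j) × c i ≈ 0# × g i ≈ᴹ lc c g)

  hull-removeAt : ∀ {k} (g : Vector Carrierᴹ (suc k)) ((i , _) : Redundant g) →
                  ConicalHull V g ≐ ConicalHull V (removeAt g i)
  hull-removeAt g (i , c , 0≤c , ci≈0 , gi≈cg) =
    hull-minimal (hull-isConvexCone _) g∈ ,
    hull-minimal (hull-isConvexCone g) (λ j → generator∈hull g (punchIn i j))
    where
    g∈ : ∀ j → g j ∈ ConicalHull V (removeAt g i)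
    g∈ j with i Fin.≟ j
    ... | yes ≡.refl = removeAt c i , (λ j → 0≤c (punchIn i j)) , (begin
      g i                                               ≈⟨ gi≈cg ⟩
      lc c g                                            ≈⟨ sum-remove {i = i} (λ j → c j *ₗ g j) ⟩
      c i *ₗ g i +ᴹ lc (removeAt c i) (removeAt g i)    ≈⟨ +ᴹ-congʳ (x≈0⇒x*y≈0 ci≈0) ⟩
      0ᴹ +ᴹ lc (removeAt c i) (removeAt g i)            ≈⟨ +ᴹ-identityˡ _ ⟩
      lc (removeAt c i) (removeAt g i)                  ∎)
    ... | no i≢j = ≡.subst (λ j → g j ∈ ConicalHull V (removeAt g i)) (punchIn-punchOut i≢j)
                           (generator∈hull (removeAt g i) (punchOut i≢j))

  -- Discarding one redundant generator at a time keeps the hull and shortens the family, so it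
  -- ends; excluded middle decides redundancy.
  irredundantGenerators : ∀ {k} (g : Vector Carrierᴹ k) →
    ∃[ k′ ] Σ (Vector Carrierᴹ k′) λ g′ → ¬ Redundant g′ × ConicalHull V g ≐ ConicalHull V g′
  irredundantGenerators {zero}  g = zero , g , (λ ()) , id , id
  irredundantGenerators {suc k} g with excludedMiddle (Redundant g)
  ... | no ¬redundant = suc k , g , ¬redundant , id , id
  ... | yes redundant with irredundantGenerators (removeAt g (proj₁ redundant))
                         | hull-removeAt g redundant
  ...   | k′ , g′ , ¬redundant , ⊆g′ , g′⊆ | g⊆ , ⊆g =
    k′ , g′ , ¬redundant , (⊆g′ ∘ g⊆) , (⊆g ∘ g′⊆)

  -- Here `y` is opposite to `x`, so the negative multiples of `x` are nonnegative multiples of `y`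
  -- and the whole line through `x` lies in `C`.
  pointed-sum-zero : ∀ {C} → IsConvexCone V C → IsPointed V C →
                     ∀ {x y} → x ∈ C → y ∈ C → x +ᴹ y ≈ᴹ 0ᴹ → x ≈ᴹ 0ᴹ
  pointed-sum-zero {C} C-cone pointed {x} {y} x∈C y∈C x+y≈0 =
    pointed (Combinations (const {B = Fin 1} x)) (combinations-isSubspace (const x)) line⊆C x
            (generator∈combinations (const x) zero)
    where
    open IsConvexCone C-cone
    line⊆C : Combinations (const {B = Fin 1} x) ⊆ C
    line⊆C {z} (c , z≈cx) with nonneg-total (c zero)
    ... | inj₁ 0≤t = resp (≈ᴹ-sym (≈ᴹ-trans z≈cx (+ᴹ-identityʳ _))) (*∈ 0≤t x∈C)
    ... | inj₂ 0≤-t = resp (≈ᴹ-sym (begin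
      z                                              ≈⟨ ≈ᴹ-trans z≈cx (+ᴹ-identityʳ _) ⟩
      c zero *ₗ x                                    ≈⟨ +ᴹ-identityʳ _ ⟨
      c zero *ₗ x +ᴹ 0ᴹ                              ≈⟨ +ᴹ-congˡ (*ₗ-neg-cancel (c zero) y) ⟨
      c zero *ₗ x +ᴹ (c zero *ₗ y +ᴹ (- c zero) *ₗ y) ≈⟨ +ᴹ-assoc _ _ _ ⟨
      (c zero *ₗ x +ᴹ c zero *ₗ y) +ᴹ (- c zero) *ₗ y ≈⟨ +ᴹ-congʳ (*ₗ-distribˡ (c zero) x y) ⟨
      c zero *ₗ (x +ᴹ y) +ᴹ (- c zero) *ₗ y          ≈⟨ +ᴹ-congʳ (y≈0⇒x*y≈0 x+y≈0) ⟩
      0ᴹ +ᴹ (- c zero) *ₗ y                          ≈⟨ +ᴹ-identityˡ _ ⟩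
      (- c zero) *ₗ y                                ∎)) (*∈ 0≤-t y∈C)

  Ray : Carrierᴹ → Pred Carrierᴹ 0ℓ
  Ray v x = ∃[ t ] (0# ≤ t × x ≈ᴹ t *ₗ v)

  ray-isConvexCone : ∀ v → IsConvexCone V (Ray v)
  ray-isConvexCone v = record
    { resp = λ x≈y (t , 0≤t , x≈tv) → t , 0≤t , ≈ᴹ-trans (≈ᴹ-sym x≈y) x≈tv
    ; 0∈   = 0# , 0≤0 , ≈ᴹ-sym (*ₗ-zeroˡ v)
    ; +∈   = λ (s , 0≤s , x≈sv) (t , 0≤t , y≈tv) → s + t , +-nonneg 0≤s 0≤t ,
               ≈ᴹ-trans (+ᴹ-cong x≈sv y≈tv) (≈ᴹ-sym (*ₗ-distribʳ v s t))
    ; *∈   = λ {a} 0≤a (t , 0≤t , x≈tv) → a * t , *-nonneg 0≤a 0≤t ,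
               ≈ᴹ-trans (*ₗ-congˡ x≈tv) (≈ᴹ-sym (*ₗ-assoc a t v))
    }

  generator∈ray : ∀ v → v ∈ Ray v
  generator∈ray v = 1# , 0≤1 , ≈ᴹ-sym (*ₗ-identityˡ v)

  ray-dimension : ∀ {v} → ¬ (v ≈ᴹ 0ᴹ) → HasConeDimension V (Ray v) 1
  ray-dimension {v} v≉0 = const v , const (⊆span {S = Ray v} (generator∈ray v)) ,
    (λ { c cv≈0 zero → *ₗ-zero-scalar v≉0 (≈ᴹ-trans (≈ᴹ-sym (+ᴹ-identityʳ _)) cv≈0) }) ,
    λ x → span-minimal {S = Ray v} (combinations-isSubspace (const v))
            (λ (t , _ , x≈tv) → const t , ≈ᴹ-trans x≈tv (≈ᴹ-sym (+ᴹ-identityʳ _)))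

  line-proportional : ∀ {S} → HasConeDimension V S 1 → ∀ {x y} → x ∈ S → y ∈ S →
                      ¬ (x ≈ᴹ 0ᴹ) → ∃[ t ] y ≈ᴹ t *ₗ x
  line-proportional (b , _ , _ , coords) {x} {y} x∈S y∈S x≉0
    with coords x (⊆span x∈S) | coords y (⊆span y∈S)
  ... | c , x≈cb | d , y≈db with c zero ≟ 0#
  ...   | yes c≈0 = contradiction (≈ᴹ-trans x≈cb (≈ᴹ-trans (+ᴹ-identityʳ _) (x≈0⇒x*y≈0 c≈0))) x≉0
  ...   | no c≉0 with inverse (c zero) c≉0
  ...     | u , cu≈1 = d zero * u , (begin
    y                              ≈⟨ ≈ᴹ-trans y≈db (+ᴹ-identityʳ _) ⟩
    d zero *ₗ b zero               ≈⟨ *ₗ-congˡ (*ₗ-inverse cu≈1 (b zero)) ⟨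
    d zero *ₗ u *ₗ c zero *ₗ b zero ≈⟨ *ₗ-congˡ (*ₗ-congˡ (≈ᴹ-trans x≈cb (+ᴹ-identityʳ _))) ⟨
    d zero *ₗ u *ₗ x               ≈⟨ *ₗ-assoc _ _ _ ⟨
    (d zero * u) *ₗ x              ∎)

  module IrredundantlyGenerated
    {C : Pred Carrierᴹ 0ℓ} (pointed : IsPointed V C)
    {k} {g : Vector Carrierᴹ k} (C≐hull : C ≐ ConicalHull V g) (irredundant : ¬ Redundant g)
    where

    C-isConvexCone : IsConvexCone V C
    C-isConvexCone = record
      { resp = λ x≈y x∈C → proj₂ C≐hull (resp x≈y (proj₁ C≐hull x∈C))
      ; 0∈   = proj₂ C≐hull 0∈
      ; +∈   = λ x∈C y∈C → proj₂ C≐hull (+∈ (proj₁ C≐hull x∈C) (proj₁ C≐hull y∈C))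
      ; *∈   = λ 0≤a x∈C → proj₂ C≐hull (*∈ 0≤a (proj₁ C≐hull x∈C))
      }
      where
      open IsConvexCone (hull-isConvexCone g)

    open IsConvexCone C-isConvexCone

    g∈C : ∀ i → g i ∈ C
    g∈C i = proj₂ C≐hull (generator∈hull g i)

    lc∈C : ∀ {c} → (∀ i → 0# ≤ c i) → lc c g ∈ C
    lc∈C 0≤c = convexCone-lc C-isConvexCone 0≤c g∈C

    g≉0 : ∀ i → ¬ (g i ≈ᴹ 0ᴹ)
    g≉0 i gi≈0 = irredundant (i , const 0# , (λ _ → 0≤0) , refl ,
      ≈ᴹ-trans gi≈0 (≈ᴹ-sym (lc-zero {v = g} (λ _ → refl))))

    -- A nonnegative factor would make `g i` redundant; a nonpositive one would make `g i` and a
    -- multiple of `g j` opposite elements of a pointed cone.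
    not-proportional : ∀ {i j} → i ≢ j → ∀ t → ¬ (g i ≈ᴹ t *ₗ g j)
    not-proportional {i} {j} i≢j t gi≈tgj with nonneg-total t
    ... | inj₁ 0≤t = irredundant (i , (λ l → t * unit j l) ,
      (λ l → *-nonneg 0≤t (unit-nonneg j l)) ,
      trans (*-congˡ (unit-off-diagonal (i≢j ∘ ≡.sym))) (zeroʳ t) ,
      ≈ᴹ-trans gi≈tgj (≈ᴹ-sym (≈ᴹ-trans (lc-* t (unit j) g) (*ₗ-congˡ (lc-unit j g)))))
    ... | inj₂ 0≤-t = g≉0 i (pointed-sum-zero C-isConvexCone pointed (g∈C i) (*∈ 0≤-t (g∈C j))
      (≈ᴹ-trans (+ᴹ-congʳ gi≈tgj) (*ₗ-neg-cancel t (g j))))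

    -- Each single term and the sum of all the others are elements of `C` adding up to zero, so
    -- pointedness annuls the term.
    nonneg-relation : ∀ {c} → (∀ i → 0# ≤ c i) → lc c g ≈ᴹ 0ᴹ → ∀ i → c i ≈ 0#
    nonneg-relation {c} 0≤c cg≈0 i = *ₗ-zero-scalar (g≉0 i)
      (pointed-sum-zero C-isConvexCone pointed (*∈ (0≤c i) (g∈C i))
        (lc∈C (zeroAt-nonneg i 0≤c))
        (≈ᴹ-trans (≈ᴹ-sym (lc-zeroAt i c g)) cg≈0))

    -- This is where irredundancy makes a ray extremal. The terms other than the `i`-th add up to
    -- `d *ₗ g i` with `d = c + - e i`. For positive `d`, dividing by it exhibits `g i` as
    -- redundant; for negative `d`, pointedness applies. So the remainder vanishes, and with it each
    -- of its nonnegative coefficients.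
    ray-combination : ∀ {i c e} → (∀ j → 0# ≤ e j) → lc e g ≈ᴹ c *ₗ g i →
                      ∀ j → zeroAt i e j ≈ 0#
    ray-combination {i} {c} {e} 0≤e eg≈cgi = nonneg-relation 0≤e′ rest≈0
      where
      e′ = zeroAt i e
      0≤e′ = zeroAt-nonneg i 0≤e
      d = c + - e i
      rest≈dgi : lc e′ g ≈ᴹ d *ₗ g i
      rest≈dgi = begin
        lc e′ g                                             ≈⟨ +ᴹ-identityˡ _ ⟨
        0ᴹ +ᴹ lc e′ g                                       ≈⟨ +ᴹ-congʳ (≈ᴹ-trans (+ᴹ-comm _ _) (*ₗ-neg-cancel (e i) (g i))) ⟨
        ((- e i) *ₗ g i +ᴹ e i *ₗ g i) +ᴹ lc e′ g           ≈⟨ +ᴹ-assoc _ _ _ ⟩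
        (- e i) *ₗ g i +ᴹ (e i *ₗ g i +ᴹ lc e′ g)           ≈⟨ +ᴹ-congˡ (lc-zeroAt i e g) ⟨
        (- e i) *ₗ g i +ᴹ lc e g                            ≈⟨ +ᴹ-congˡ eg≈cgi ⟩
        (- e i) *ₗ g i +ᴹ c *ₗ g i                          ≈⟨ +ᴹ-comm _ _ ⟩
        c *ₗ g i +ᴹ (- e i) *ₗ g i                          ≈⟨ *ₗ-distribʳ (g i) c (- e i) ⟨
        d *ₗ g i                                            ∎
      rest≈0 : lc e′ g ≈ᴹ 0ᴹ
      rest≈0 with d ≟ 0# | nonneg-total d
      ... | yes d≈0 | _ = ≈ᴹ-trans rest≈dgi (x≈0⇒x*y≈0 d≈0)
      ... | no _ | inj₂ 0≤-d = pointed-sum-zero C-isConvexCone pointed (lc∈C 0≤e′)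
        (*∈ 0≤-d (g∈C i)) (≈ᴹ-trans (+ᴹ-congʳ rest≈dgi) (*ₗ-neg-cancel d (g i)))
      ... | no d≉0 | inj₁ 0≤d with inverse d d≉0
      ...   | u , du≈1 = contradiction (i , (λ j → u * e′ j) ,
        (λ j → *-nonneg (inverse-nonneg 0≤d du≈1) (0≤e′ j)) ,
        trans (*-congˡ (reflexive (updateAt-updates i e))) (zeroʳ u) , (begin
          g i                     ≈⟨ *ₗ-inverse du≈1 (g i) ⟨
          u *ₗ d *ₗ g i           ≈⟨ *ₗ-congˡ rest≈dgi ⟨
          u *ₗ lc e′ g            ≈⟨ lc-* u e′ g ⟨
          lc (λ j → u * e′ j) g   ∎)) irredundant

    -- The coefficients of `x` and `y` add up to those of a multiple of `g i`, which are supported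
    -- at `i`; being nonnegative, they cannot cancel, so both supports are confined to `i`.
    ray-isFace : ∀ i → IsFace V C (Ray (g i))
    ray-isFace i = record
      { isConvexCone = ray-isConvexCone (g i)
      ; F⊆C          = λ (t , 0≤t , x≈tgi) → resp (≈ᴹ-sym x≈tgi) (*∈ 0≤t (g∈C i))
      ; extreme      = λ x∈C y∈C x+y∈R → summand x∈C y∈C x+y∈R ,
          summand y∈C x∈C (IsConvexCone.resp (ray-isConvexCone (g i)) (+ᴹ-comm _ _) x+y∈R)
      }
      where
      summand : ∀ {x y} → x ∈ C → y ∈ C → x +ᴹ y ∈ Ray (g i) → x ∈ Ray (g i)
      summand {x} {y} x∈C y∈C (c , 0≤c , x+y≈cgi) with proj₁ C≐hull x∈C | proj₁ C≐hull y∈C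
      ... | a , 0≤a , x≈ag | b , 0≤b , y≈bg = a i , 0≤a i , (begin
        x                                   ≈⟨ x≈ag ⟩
        lc a g                              ≈⟨ lc-zeroAt i a g ⟩
        a i *ₗ g i +ᴹ lc (zeroAt i a) g     ≈⟨ +ᴹ-congˡ (lc-zero a′≈0) ⟩
        a i *ₗ g i +ᴹ 0ᴹ                    ≈⟨ +ᴹ-identityʳ _ ⟩
        a i *ₗ g i                          ∎)
        where
        a′≈0 : ∀ j → zeroAt i a j ≈ 0#
        a′≈0 j = zeroAt-zero i (λ j → nonneg-sum-zero (0≤a j) (0≤b j)) j
          (ray-combination (λ j → +-nonneg (0≤a j) (0≤b j)) (begin
            lc (λ j → a j + b j) g   ≈⟨ lc-+ a b g ⟩
            lc a g +ᴹ lc b g         ≈⟨ +ᴹ-cong x≈ag y≈bg ⟨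
            x +ᴹ y                   ≈⟨ x+y≈cgi ⟩
            c *ₗ g i                 ∎) j)

    ray-isExtremal : ∀ i → IsExtremalRay V C (Ray (g i))
    ray-isExtremal i = ray-isFace i , ray-dimension (g≉0 i)

    ray⊆face : ∀ {F i} → IsFace V C F → g i ∈ F → Ray (g i) ⊆ F
    ray⊆face F-face gi∈F (t , 0≤t , x≈tgi) = F.resp (≈ᴹ-sym x≈tgi) (F.*∈ 0≤t gi∈F)
      where
      module F = IsConvexCone (IsFace.isConvexCone F-face)

    -- The `i`-th term and the rest are two elements of `C` with sum in `F`; extremality puts the
    -- term in `F`, and a nonzero coefficient can be divided out.
    face-contains-terms : ∀ {F c} → IsFace V C F → (∀ i → 0# ≤ c i) → lc c g ∈ F →
                          ∀ i → c i ≈ 0# ⊎ g i ∈ F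
    face-contains-terms {F} {c} F-face 0≤c cg∈F i with c i ≟ 0#
    ... | yes ci≈0 = inj₁ ci≈0
    ... | no ci≉0 with inverse (c i) ci≉0
    ...   | u , ciu≈1 = inj₂ (F.resp (*ₗ-inverse ciu≈1 (g i))
      (F.*∈ (inverse-nonneg (0≤c i) ciu≈1) (proj₁ (IsFace.extreme F-face
        (*∈ (0≤c i) (g∈C i)) (lc∈C (zeroAt-nonneg i 0≤c)) (F.resp (lc-zeroAt i c g) cg∈F)))))
      where
      module F = IsConvexCone (IsFace.isConvexCone F-face)

    -- Applied to the zero subspace when a face contains no generator, and to the span of the
    -- generators in a facet.
    face-generated : ∀ {F L} → IsFace V C F → IsSubspace V L →
                     (∀ i → g i ∈ F → g i ∈ L) → F ⊆ L
    face-generated {F} {L} F-face L-sub g∈L {x} x∈F with proj₁ C≐hull (IsFace.F⊆C F-face x∈F)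
    ... | c , 0≤c , x≈cg = L.resp (≈ᴹ-sym (≈ᴹ-trans x≈cg (≈ᴹ-sym terms)))
                             (subspace-lc {c = λ _ → 1#} {v = λ i → c i *ₗ g i} L-sub term∈L)
      where
      module L = IsSubspace L-sub
      -- The scaled vectors, not the `g i`, are taken as the family: a `g i` with coefficient zero
      -- may lie outside `L`, while its term does not.
      terms : lc (λ _ → 1#) (λ i → c i *ₗ g i) ≈ᴹ lc c g
      terms = sum-cong-≋ (λ i → *ₗ-identityˡ (c i *ₗ g i))
      term∈L : ∀ i → c i *ₗ g i ∈ L
      term∈L i with face-contains-terms F-face 0≤c
        (IsConvexCone.resp (IsFace.isConvexCone F-face) x≈cg x∈F) i
      ... | inj₁ ci≈0 = L.resp (≈ᴹ-sym (x≈0⇒x*y≈0 ci≈0)) L.0∈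
      ... | inj₂ gi∈F = L.*∈ (c i) (g∈L i gi∈F)

    -- A face without generators lies in the zero subspace, but the span of `R` has the nonzero
    -- basis vector `b zero`.
    extremalRay-contains-generator : ∀ {R} → IsExtremalRay V C R → ∃[ i ] g i ∈ R
    extremalRay-contains-generator {R} (R-face , b , b∈R , b-independent , _)
      with any? (λ i → excludedMiddle (g i ∈ R))
    ... | yes found = found
    ... | no none = contradiction
      (span-minimal trivial (face-generated R-face trivial (λ i gi∈R → ⊥-elim (none (i , gi∈R))))
        (b∈R zero))
      (independent-nonzero {v = b} b-independent zero)
      where
      trivial : IsSubspace V (_≈ᴹ 0ᴹ)
      trivial = record
        { resp = λ x≈y x≈0 → ≈ᴹ-trans (≈ᴹ-sym x≈y) x≈0
        ; 0∈   = ≈ᴹ-refl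
        ; +∈   = λ x≈0 y≈0 → ≈ᴹ-trans (+ᴹ-cong x≈0 y≈0) (+ᴹ-identityˡ 0ᴹ)
        ; *∈   = λ _ → y≈0⇒x*y≈0
        }

    extremalRay-classification : ∀ {R} → IsExtremalRay V C R → ∃[ i ] R ≐ Ray (g i)
    extremalRay-classification {R} R-extremal@(R-face , R-line) with extremalRay-contains-generator R-extremal
    ... | i , gi∈R = i , R⊆ray , ray⊆face R-face gi∈R
      where
      R⊆ray : R ⊆ Ray (g i)
      R⊆ray {y} y∈R with line-proportional R-line gi∈R y∈R (g≉0 i)
      ... | t , y≈tgi with nonneg-total t
      ...   | inj₁ 0≤t = t , 0≤t , y≈tgi
      -- With a nonpositive factor, `y` is opposite to an element of the cone and hence zero, which
      -- still lies on the ray.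
      ...   | inj₂ 0≤-t = 0# , 0≤0 , ≈ᴹ-trans
        (pointed-sum-zero C-isConvexCone pointed (IsFace.F⊆C R-face y∈R) (*∈ 0≤-t (g∈C i))
          (≈ᴹ-trans (+ᴹ-congʳ y≈tgi) (*ₗ-neg-cancel t (g i))))
        (≈ᴹ-sym (*ₗ-zeroˡ (g i)))

    ray-injective : ∀ {i j} → Ray (g i) ⊆ Ray (g j) → i ≡ j
    ray-injective {i} {j} i⊆j with i Fin.≟ j | i⊆j (generator∈ray (g i))
    ... | yes i≡j | _ = i≡j
    ... | no i≢j | t , _ , gi≈tgj = contradiction gi≈tgj (not-proportional i≢j t)

-- Multilinear maps on the diagonal.

module Multilinear (ℝ : CompleteOrderedField) (V M : RealGeometry.VectorSpace ℝ) where
  open OrderedField ℝ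
  open RealGeometry ℝ hiding (module ℝ)
  private
    module V = Module V
  open Module M
  open LinearAlgebra ℝ M
  open CommutativeSemigroupProperties (CommutativeMonoid.commutativeSemigroup +ᴹ-commutativeMonoid)
    using (interchange)
  open RawSemiringDefinitions (Semiring.rawSemiring semiring) using (_^_)
  open SetoidReasoning ≈ᴹ-setoid

  -- The fields copy the relations imposed on `pure`. A general target is needed for induction: with
  -- its first argument fixed, `pure` has fewer arguments but still takes values in the same tensor
  -- power.
  record IsMultilinear {n} (f : Vector ∣ V ∣ n → Carrierᴹ) : Set where
    field
      cong   : ∀ {v w} → (∀ i → v i V.≈ᴹ w i) → f v ≈ᴹ f w
      +-homo : ∀ v i x y → f (updateAt v i (const (x V.+ᴹ y))) ≈ᴹ
                 f (updateAt v i (const x)) +ᴹ f (updateAt v i (const y))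
      *-homo : ∀ v i a x → f (updateAt v i (const (a V.*ₗ x))) ≈ᴹ
                 a *ₗ f (updateAt v i (const x))

  open IsMultilinear

  private
    ∷-cong : ∀ {n x y} {v w : Vector ∣ V ∣ n} → x V.≈ᴹ y → (∀ i → v i V.≈ᴹ w i) →
             ∀ i → (x ∷ v) i V.≈ᴹ (y ∷ w) i
    ∷-cong x≈y v≈w zero    = x≈y
    ∷-cong x≈y v≈w (suc i) = v≈w i

    ∷-η : ∀ {n} z i → z V.≈ᴹ (z ∷ λ (_ : Fin n) → z) i
    ∷-η z zero    = V.≈ᴹ-refl
    ∷-η z (suc i) = V.≈ᴹ-refl

    updateAt-head : ∀ {n} {x : ∣ V ∣} (v : Vector ∣ V ∣ n) z i →
                    updateAt (x ∷ v) zero (const z) i V.≈ᴹ (z ∷ v) i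
    updateAt-head v z zero    = V.≈ᴹ-refl
    updateAt-head v z (suc i) = V.≈ᴹ-refl

    updateAt-tail : ∀ {n} x (v : Vector ∣ V ∣ n) i z j →
                    updateAt (x ∷ v) (suc i) (const z) j V.≈ᴹ (x ∷ updateAt v i (const z)) j
    updateAt-tail x v i z zero    = V.≈ᴹ-refl
    updateAt-tail x v i z (suc j) = V.≈ᴹ-refl

  head-+ : ∀ {n} {f : Vector ∣ V ∣ (suc n) → Carrierᴹ} → IsMultilinear f →
           ∀ x y v → f ((x V.+ᴹ y) ∷ v) ≈ᴹ f (x ∷ v) +ᴹ f (y ∷ v)
  head-+ {f = f} F x y v = begin
    f ((x V.+ᴹ y) ∷ v)                                      ≈⟨ cong F (updateAt-head {x = x} v _) ⟨
    f (updateAt (x ∷ v) zero (const (x V.+ᴹ y)))            ≈⟨ +-homo F (x ∷ v) zero x y ⟩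
    f (updateAt (x ∷ v) zero (const x)) +ᴹ f (updateAt (x ∷ v) zero (const y))
      ≈⟨ +ᴹ-cong (cong F (updateAt-head v x)) (cong F (updateAt-head v y)) ⟩
    f (x ∷ v) +ᴹ f (y ∷ v)                                  ∎

  head-* : ∀ {n} {f : Vector ∣ V ∣ (suc n) → Carrierᴹ} → IsMultilinear f →
           ∀ a x v → f ((a V.*ₗ x) ∷ v) ≈ᴹ a *ₗ f (x ∷ v)
  head-* {f = f} F a x v = begin
    f ((a V.*ₗ x) ∷ v)                                      ≈⟨ cong F (updateAt-head {x = x} v _) ⟨
    f (updateAt (x ∷ v) zero (const (a V.*ₗ x)))            ≈⟨ *-homo F (x ∷ v) zero a x ⟩
    a *ₗ f (updateAt (x ∷ v) zero (const x))                ≈⟨ *ₗ-congˡ (cong F (updateAt-head v x)) ⟩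
    a *ₗ f (x ∷ v)                                          ∎

  tail-multilinear : ∀ {n} {f : Vector ∣ V ∣ (suc n) → Carrierᴹ} → IsMultilinear f →
                     ∀ x → IsMultilinear (λ v → f (x ∷ v))
  tail-multilinear F x = record
    { cong   = λ v≈w → cong F (∷-cong V.≈ᴹ-refl v≈w)
    ; +-homo = λ v i y z → ≈ᴹ-trans (≈ᴹ-sym (cong F (updateAt-tail x v i _)))
                 (≈ᴹ-trans (+-homo F (x ∷ v) (suc i) y z)
                   (+ᴹ-cong (cong F (updateAt-tail x v i y)) (cong F (updateAt-tail x v i z))))
    ; *-homo = λ v i a y → ≈ᴹ-trans (≈ᴹ-sym (cong F (updateAt-tail x v i _)))
                 (≈ᴹ-trans (*-homo F (x ∷ v) (suc i) a y)
                   (*ₗ-congˡ (cong F (updateAt-tail x v i y))))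
    }

  diagonal-* : ∀ {n} {f : Vector ∣ V ∣ n → Carrierᴹ} → IsMultilinear f →
               ∀ a x → f (λ _ → a V.*ₗ x) ≈ᴹ a ^ n *ₗ f (λ _ → x)
  diagonal-* {zero}  F a x = ≈ᴹ-trans (cong F (λ ())) (≈ᴹ-sym (*ₗ-identityˡ _))
  diagonal-* {suc n} {f} F a x = begin
    f (λ _ → a V.*ₗ x)                    ≈⟨ cong F (∷-η (a V.*ₗ x)) ⟩
    f ((a V.*ₗ x) ∷ λ _ → a V.*ₗ x)       ≈⟨ head-* F a x _ ⟩
    a *ₗ f (x ∷ λ _ → a V.*ₗ x)           ≈⟨ *ₗ-congˡ (diagonal-* (tail-multilinear F x) a x) ⟩
    a *ₗ a ^ n *ₗ f (x ∷ λ _ → x)         ≈⟨ *ₗ-assoc a (a ^ n) _ ⟨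
    a ^ suc n *ₗ f (x ∷ λ _ → x)          ≈⟨ *ₗ-congˡ (cong F (∷-η x)) ⟨
    a ^ suc n *ₗ f (λ _ → x)              ∎

  -- The i-th entry is xⁿ⁻ⁱ yⁱ.
  monomials : ∀ n → Carrier → Carrier → Vector Carrier (suc n)
  monomials zero    x y = const 1#
  monomials (suc n) x y = (x * monomials n x y zero) ∷ λ i → y * monomials n x y i

  private
    -- Reading a vector as the coefficients of a binary form, multiplication by `x` appends a zero
    -- at the top power of `y`, and multiplication by `y` puts a zero in front.
    pad : ∀ {n} → Vector Carrierᴹ n → Vector Carrierᴹ (suc n)
    pad {zero}  s = const 0ᴹ
    pad {suc n} s = s zero ∷ pad (tail s)

    monomials-pad : ∀ {n} x y (s : Vector Carrierᴹ (suc n)) →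
                    lc (monomials (suc n) x y) (pad s) ≈ᴹ x *ₗ lc (monomials n x y) s
    monomials-pad {n} x y s = begin
      (x * monomials n x y zero) *ₗ s zero +ᴹ lc (λ i → y * monomials n x y i) (pad (tail s))
        ≈⟨ +ᴹ-cong (*ₗ-assoc x _ _) (rest n s) ⟩
      x *ₗ monomials n x y zero *ₗ s zero +ᴹ x *ₗ lc (tail (monomials n x y)) (tail s)
        ≈⟨ *ₗ-distribˡ x _ _ ⟨
      x *ₗ lc (monomials n x y) s ∎
      where
      rest : ∀ n (s : Vector Carrierᴹ (suc n)) →
        lc (λ i → y * monomials n x y i) (pad (tail s)) ≈ᴹ x *ₗ lc (tail (monomials n x y)) (tail s)
      rest zero s = ≈ᴹ-trans (≈ᴹ-trans (+ᴹ-identityʳ _) (*ₗ-zeroʳ (y * 1#))) (≈ᴹ-sym (*ₗ-zeroʳ x))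
      rest (suc n) s = begin
        lc (λ i → y * monomials (suc n) x y i) (pad (tail s))
          ≈⟨ lc-* y (monomials (suc n) x y) (pad (tail s)) ⟩
        y *ₗ lc (monomials (suc n) x y) (pad (tail s))
          ≈⟨ *ₗ-congˡ (monomials-pad x y (tail s)) ⟩
        y *ₗ x *ₗ lc (monomials n x y) (tail s)
          ≈⟨ ≈ᴹ-trans (≈ᴹ-sym (*ₗ-assoc y x _)) (≈ᴹ-trans (*ₗ-congʳ (*-comm y x)) (*ₗ-assoc x y _)) ⟩
        x *ₗ y *ₗ lc (monomials n x y) (tail s)
          ≈⟨ *ₗ-congˡ (lc-* y (monomials n x y) (tail s)) ⟨
        x *ₗ lc (λ i → y * monomials n x y i) (tail s) ∎

    monomials-shift : ∀ {n} x y (s : Vector Carrierᴹ (suc n)) →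
                      lc (monomials (suc n) x y) (0ᴹ ∷ s) ≈ᴹ y *ₗ lc (monomials n x y) s
    monomials-shift {n} x y s = ≈ᴹ-trans (+ᴹ-congʳ (*ₗ-zeroʳ _))
      (≈ᴹ-trans (+ᴹ-identityˡ _) (lc-* y (monomials n x y) s))

    lc-+ᴹ : ∀ {n} (c : Vector Carrier n) (v w : Vector Carrierᴹ n) →
            lc c (λ i → v i +ᴹ w i) ≈ᴹ lc c v +ᴹ lc c w
    lc-+ᴹ {zero}  c v w = ≈ᴹ-sym (+ᴹ-identityˡ 0ᴹ)
    lc-+ᴹ {suc n} c v w = ≈ᴹ-trans
      (+ᴹ-cong (*ₗ-distribˡ (c zero) (v zero) (w zero)) (lc-+ᴹ (tail c) (tail v) (tail w)))
      (interchange _ _ _ _)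

  -- What matters is that `s` does not depend on `x` and `y`. Its `i`-th entry collects the values
  -- of `f` on all words with `i` letters `e` and the rest `d`, so no binomial coefficients appear.
  diagonal-expansion : ∀ {n} {f : Vector ∣ V ∣ n → Carrierᴹ} → IsMultilinear f → ∀ d e →
    Σ (Vector Carrierᴹ (suc n)) λ s →
    ∀ x y → f (λ _ → x V.*ₗ d V.+ᴹ y V.*ₗ e) ≈ᴹ lc (monomials n x y) s
  diagonal-expansion {zero}  {f} F d e = const (f λ ()) , λ x y → ≈ᴹ-trans (cong F (λ ()))
    (≈ᴹ-sym (≈ᴹ-trans (+ᴹ-identityʳ _) (*ₗ-identityˡ _)))
  diagonal-expansion {suc n} {f} F d e with diagonal-expansion (tail-multilinear F d) d e
                                          | diagonal-expansion (tail-multilinear F e) d e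
  ... | s , s-expands | t , t-expands = (λ i → pad s i +ᴹ (0ᴹ ∷ t) i) , λ x y → begin
    f (λ _ → z x y)                                          ≈⟨ cong F (∷-η (z x y)) ⟩
    f ((x V.*ₗ d V.+ᴹ y V.*ₗ e) ∷ Z x y)                     ≈⟨ head-+ F _ _ _ ⟩
    f ((x V.*ₗ d) ∷ Z x y) +ᴹ f ((y V.*ₗ e) ∷ Z x y)
      ≈⟨ +ᴹ-cong (head-* F x d _) (head-* F y e _) ⟩
    x *ₗ f (d ∷ Z x y) +ᴹ y *ₗ f (e ∷ Z x y)
      ≈⟨ +ᴹ-cong (*ₗ-congˡ (s-expands x y)) (*ₗ-congˡ (t-expands x y)) ⟩
    x *ₗ lc (monomials n x y) s +ᴹ y *ₗ lc (monomials n x y) t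
      ≈⟨ +ᴹ-cong (monomials-pad x y s) (monomials-shift x y t) ⟨
    lc (monomials (suc n) x y) (pad s) +ᴹ lc (monomials (suc n) x y) (0ᴹ ∷ t)
      ≈⟨ lc-+ᴹ (monomials (suc n) x y) (pad s) (0ᴹ ∷ t) ⟨
    lc (monomials (suc n) x y) (λ i → pad s i +ᴹ (0ᴹ ∷ t) i)  ∎
    where
    z : Carrier → Carrier → ∣ V ∣
    z x y = x V.*ₗ d V.+ᴹ y V.*ₗ e
    Z : Carrier → Carrier → Vector ∣ V ∣ n
    Z x y _ = z x y

-- Evaluation of tensors and a criterion for independent powers.

module TensorEvaluation (ℝ : CompleteOrderedField) (W : RealGeometry.VectorSpace ℝ) (m : ℕ) where
  open OrderedField ℝ
  open RealGeometry ℝ hiding (module ℝ)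
  private
    W* = Dual W
    module W* = Module W*
    T = TensorPower W* m
    module T = Module T
  open LinearAlgebra ℝ T using (lc; zeroAt; lc-zeroAt)
  open MonoidSum *-commutativeMonoid using () renaming (sum to product; sum-cong-≋ to product-cong)
  open CommutativeSemigroupProperties *-commutativeSemigroup using (x∙yz≈y∙xz)
  open SetoidReasoning setoid

  private
    -- The cofactor `r`, the product over the other slots, is the same for all `α`; multilinearity
    -- of the product is then distributivity and associativity.
    product-updateAt : ∀ {n} (v : Vector (LinearForm W) n) (w : Vector ∣ W ∣ n) i →
      ∃[ r ] ∀ α → product (λ k → proj₁ (updateAt v i (const α) k) (w k)) ≈ proj₁ α (w i) * r
    product-updateAt v w zero = product (λ k → proj₁ (v (suc k)) (w (suc k))) , λ α → refl
    product-updateAt v w (suc i) with product-updateAt (tail v) (tail w) i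
    ... | r , factors = proj₁ (v zero) (w zero) * r , λ α →
      trans (*-congˡ (factors α)) (x∙yz≈y∙xz _ _ _)

  -- Contraction with `w` slot by slot, defined on formal expressions; `evaluate-cong` shows that it
  -- descends to tensors.
  evaluate : Vector ∣ W ∣ m → Tensor W* m → Carrier
  evaluate w 𝟘        = 0#
  evaluate w (s ⊕ t)  = evaluate w s + evaluate w t
  evaluate w (a ⊙ t)  = a * evaluate w t
  evaluate w (pure v) = product (λ k → proj₁ (v k) (w k))

  evaluate-cong : ∀ w {s t} → s T.≈ᴹ t → evaluate w s ≈ evaluate w t
  evaluate-cong w ≋-refl              = refl
  evaluate-cong w (≋-sym p)           = sym (evaluate-cong w p)
  evaluate-cong w (≋-trans p q)       = trans (evaluate-cong w p) (evaluate-cong w q)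
  evaluate-cong w (⊕-cong p q)        = +-cong (evaluate-cong w p) (evaluate-cong w q)
  evaluate-cong w (⊕-assoc s t u)     = +-assoc _ _ _
  evaluate-cong w (⊕-comm s t)        = +-comm _ _
  evaluate-cong w (⊕-identityˡ t)     = +-identityˡ _
  evaluate-cong w (⊙-cong p q)        = *-cong p (evaluate-cong w q)
  evaluate-cong w (⊙-zeroˡ t)         = zeroˡ _
  evaluate-cong w (⊙-identityˡ t)     = *-identityˡ _
  evaluate-cong w (⊙-assoc a b t)     = *-assoc _ _ _
  evaluate-cong w (⊙-distribˡ a s t)  = distribˡ _ _ _
  evaluate-cong w (⊙-distribʳ t a b)  = distribʳ _ _ _
  evaluate-cong w (pure-cong v≈v′)    = product-cong (λ k → v≈v′ k (w k))
  evaluate-cong w (pure-+ v i α β) with product-updateAt v w i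
  ... | r , factors = trans (factors (α W*.+ᴹ β))
    (trans (distribʳ r _ _) (sym (+-cong (factors α) (factors β))))
  evaluate-cong w (pure-* v i a α) with product-updateAt v w i
  ... | r , factors = trans (factors (a W*.*ₗ α))
    (trans (*-assoc a _ r) (sym (*-congˡ (factors α))))

  private
    product-zero : ∀ {n} {f : Vector Carrier n} k → f k ≈ 0# → product f ≈ 0#
    product-zero zero    fk≈0 = trans (*-congʳ fk≈0) (zeroˡ _)
    product-zero (suc k) fk≈0 = trans (*-congˡ (product-zero k fk≈0)) (zeroʳ _)

    product-nonzero : ∀ {n} {f : Vector Carrier n} → (∀ k → ¬ (f k ≈ 0#)) → ¬ (product f ≈ 0#)
    product-nonzero {zero}  f≉0 = 1≉0
    product-nonzero {suc n} f≉0 = *-nonzero (f≉0 zero) (product-nonzero (f≉0 ∘ suc))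

    evaluate-lc-zero : ∀ w {n} (c : Vector Carrier n) (u : Vector (Tensor W* m) n) →
      (∀ i → c i * evaluate w (u i) ≈ 0#) → evaluate w (lc c u) ≈ 0#
    evaluate-lc-zero w {zero}  c u zeros = refl
    evaluate-lc-zero w {suc n} c u zeros = trans
      (+-cong (zeros zero) (evaluate-lc-zero w (tail c) (tail u) (zeros ∘ suc))) (+-identityˡ 0#)

  -- Each `w` acts as a dual functional. A power evaluates to a product over the slots, so one
  -- vanishing slot kills it, whereas the power to be isolated must survive in every slot.
  powers-independent : ∀ {n} (α : Vector (LinearForm W) n) (d : Vector Carrier n) {u} →
    (∀ i → u i T.≈ᴹ d i ⊙ pure (λ _ → α i)) → (∀ i → ¬ (d i ≈ 0#)) →
    (∀ i → Σ (Vector ∣ W ∣ m) λ w → (∀ k → ¬ (proj₁ (α i) (w k) ≈ 0#)) ×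
             (∀ j → i ≢ j → ∃[ k ] proj₁ (α j) (w k) ≈ 0#)) →
    LinearlyIndependent T u
  powers-independent α d {u} u≈dα d≉0 separated c cu≈0 i with separated i
  ... | w , αi≉0 , αj≈0 with c i ≟ 0#
  ...   | yes ci≈0 = ci≈0
  ...   | no ci≉0 = contradiction (begin
    c i * (d i * product (λ k → proj₁ (α i) (w k)))     ≈⟨ *-congˡ (evaluate-cong w (u≈dα i)) ⟨
    c i * evaluate w (u i)                              ≈⟨ +-identityʳ _ ⟨
    c i * evaluate w (u i) + 0#                         ≈⟨ +-congˡ (evaluate-lc-zero w (zeroAt i c) u rest) ⟨
    c i * evaluate w (u i) + evaluate w (lc (zeroAt i c) u)  ≈⟨ evaluate-cong w (lc-zeroAt i c u) ⟨
    evaluate w (lc c u)                                 ≈⟨ evaluate-cong w cu≈0 ⟩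
    0#                                                  ∎)
    (*-nonzero ci≉0 (*-nonzero (d≉0 i) (product-nonzero αi≉0)))
    where
    rest : ∀ j → zeroAt i c j * evaluate w (u j) ≈ 0#
    rest j with i Fin.≟ j
    ... | yes ≡.refl = trans (*-congʳ (reflexive (updateAt-updates i c))) (zeroˡ _)
    ... | no i≢j with αj≈0 j i≢j
    ...   | k , αjwk≈0 = trans (*-congˡ (trans (evaluate-cong w (u≈dα j))
      (trans (*-congˡ (product-zero k αjwk≈0)) (zeroʳ (d j))))) (zeroʳ _)

-- Linear forms on the plane.

module Plane (ℝ : CompleteOrderedField) (W : RealGeometry.VectorSpace ℝ)
             (dim : RealGeometry.HasDimension ℝ W U 2) where
  open OrderedField ℝ
  open RealGeometry ℝ hiding (module ℝ)
  private
    W* = Dual W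
    module W* = Module W*
  open Module W
  open LinearAlgebra ℝ W
  open LeftModuleMorphisms rawLeftModule (TensorUnit.rawLeftModule {R = rawRing})
    using (module IsLeftModuleHomomorphism)
  open IsLeftModuleHomomorphism
  open CommutativeSemigroupProperties *-commutativeSemigroup using (x∙yz≈y∙xz)
  open SetoidReasoning setoid

  basis : Vector Carrierᴹ 2
  basis = proj₁ dim

  b₀ b₁ : Carrierᴹ
  b₀ = basis zero
  b₁ = basis (suc zero)

  basis-independent : LinearlyIndependent W basis
  basis-independent = proj₁ (proj₂ (proj₂ dim))

  coordinates : Carrierᴹ → Vector Carrier 2
  coordinates x = proj₁ (proj₂ (proj₂ (proj₂ dim)) x tt)

  coordinates-lc : ∀ x → x ≈ᴹ lc (coordinates x) basis
  coordinates-lc x = proj₂ (proj₂ (proj₂ (proj₂ dim)) x tt)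

  coordinates-unique : ∀ {x} c → x ≈ᴹ lc c basis → ∀ i → coordinates x i ≈ c i
  coordinates-unique {x} c x≈cb = independent-unique {v = basis} basis-independent (coordinates x) c
    (≈ᴹ-trans (≈ᴹ-sym (coordinates-lc x)) x≈cb)

  -- The dual basis. The coordinates come from a mere choice for each vector; their uniqueness makes
  -- them respect equality and be linear.
  coordinateForm : Fin 2 → LinearForm W
  coordinateForm i = f , record
    { +ᴹ-isGroupHomomorphism = record
      { isMonoidHomomorphism = record
        { isMagmaHomomorphism = record
          { isRelHomomorphism = record { cong = f-cong }
          ; homo = f-+ }
        ; ε-homo = f-0 }
      ; ⁻¹-homo = λ x → RingProperties.+-inverseˡ-unique ring _ _
          (trans (sym (f-+ (-ᴹ x) x)) (trans (f-cong (-ᴹ‿inverseˡ x)) f-0)) }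
    ; *ₗ-homo = λ a x → coordinates-unique (λ i → a * coordinates x i)
        (≈ᴹ-trans (*ₗ-congˡ (coordinates-lc x)) (≈ᴹ-sym (lc-* a (coordinates x) basis))) i }
    where
    f : Carrierᴹ → Carrier
    f x = coordinates x i
    f-cong : ∀ {x y} → x ≈ᴹ y → f x ≈ f y
    f-cong {x} {y} x≈y = coordinates-unique (coordinates y) (≈ᴹ-trans x≈y (coordinates-lc y)) i
    f-+ : ∀ x y → f (x +ᴹ y) ≈ f x + f y
    f-+ x y = coordinates-unique (λ i → coordinates x i + coordinates y i) (≈ᴹ-trans
      (+ᴹ-cong (coordinates-lc x) (coordinates-lc y))
      (≈ᴹ-sym (lc-+ (coordinates x) (coordinates y) basis))) i
    f-0 : f 0ᴹ ≈ 0#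
    f-0 = coordinates-unique (const 0#) (≈ᴹ-sym (lc-zero {v = basis} (λ _ → refl))) i

  coordinateForm-basis : ∀ i j → proj₁ (coordinateForm i) (basis j) ≈ unit j i
  coordinateForm-basis i j = coordinates-unique (unit j) (≈ᴹ-sym (lc-unit j basis)) i

  form-lc : ∀ (α : LinearForm W) c →
            proj₁ α (lc c basis) ≈ c zero * proj₁ α b₀ + c (suc zero) * proj₁ α b₁
  form-lc (α , α-linear) c = begin
    α (c zero *ₗ b₀ +ᴹ (c (suc zero) *ₗ b₁ +ᴹ 0ᴹ))
      ≈⟨ ⟦⟧-cong α-linear (+ᴹ-congˡ (+ᴹ-identityʳ _)) ⟩
    α (c zero *ₗ b₀ +ᴹ c (suc zero) *ₗ b₁)
      ≈⟨ +ᴹ-homo α-linear _ _ ⟩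
    α (c zero *ₗ b₀) + α (c (suc zero) *ₗ b₁)
      ≈⟨ +-cong (*ₗ-homo α-linear _ _) (*ₗ-homo α-linear _ _) ⟩
    c zero * α b₀ + c (suc zero) * α b₁ ∎

  form-determined : ∀ (α β : LinearForm W) → proj₁ α b₀ ≈ proj₁ β b₀ → proj₁ α b₁ ≈ proj₁ β b₁ →
                    α W*.≈ᴹ β
  form-determined α β α₀≈β₀ α₁≈β₁ x = begin
    proj₁ α x                                  ≈⟨ ⟦⟧-cong (proj₂ α) (coordinates-lc x) ⟩
    proj₁ α (lc (coordinates x) basis)         ≈⟨ form-lc α (coordinates x) ⟩
    coordinates x zero * proj₁ α b₀ + coordinates x (suc zero) * proj₁ α b₁
      ≈⟨ +-cong (*-congˡ α₀≈β₀) (*-congˡ α₁≈β₁) ⟩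
    coordinates x zero * proj₁ β b₀ + coordinates x (suc zero) * proj₁ β b₁
      ≈⟨ form-lc β (coordinates x) ⟨
    proj₁ β (lc (coordinates x) basis)         ≈⟨ ⟦⟧-cong (proj₂ β) (coordinates-lc x) ⟨
    proj₁ β x                                  ∎

  e₀ e₁ : LinearForm W
  e₀ = coordinateForm zero
  e₁ = coordinateForm (suc zero)

  combination-b₀ : ∀ x y → proj₁ (x W*.*ₗ e₀ W*.+ᴹ y W*.*ₗ e₁) b₀ ≈ x
  combination-b₀ x y = begin
    x * proj₁ e₀ b₀ + y * proj₁ e₁ b₀
      ≈⟨ +-cong (*-congˡ (coordinateForm-basis zero zero))
                (*-congˡ (coordinateForm-basis (suc zero) zero)) ⟩
    x * 1# + y * 0#   ≈⟨ +-cong (*-identityʳ x) (zeroʳ y) ⟩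
    x + 0#            ≈⟨ +-identityʳ x ⟩
    x                 ∎

  combination-b₁ : ∀ x y → proj₁ (x W*.*ₗ e₀ W*.+ᴹ y W*.*ₗ e₁) b₁ ≈ y
  combination-b₁ x y = begin
    x * proj₁ e₀ b₁ + y * proj₁ e₁ b₁
      ≈⟨ +-cong (*-congˡ (coordinateForm-basis zero (suc zero)))
                (*-congˡ (coordinateForm-basis (suc zero) (suc zero))) ⟩
    x * 0# + y * 1#   ≈⟨ +-cong (zeroʳ x) (*-identityʳ y) ⟩
    0# + y            ≈⟨ +-identityˡ y ⟩
    y                 ∎

  form-expansion : ∀ α → α W*.≈ᴹ proj₁ α b₀ W*.*ₗ e₀ W*.+ᴹ proj₁ α b₁ W*.*ₗ e₁
  form-expansion α = form-determined α (proj₁ α b₀ W*.*ₗ e₀ W*.+ᴹ proj₁ α b₁ W*.*ₗ e₁)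
    (sym (combination-b₀ _ _)) (sym (combination-b₁ _ _))

  -- Spans the kernel of a nonzero form. The value of `α` on `kernelVector β` is, up to sign, the
  -- determinant of the two forms.
  kernelVector : LinearForm W → Carrierᴹ
  kernelVector α = lc (proj₁ α b₁ ∷ const (- proj₁ α b₀)) basis

  form-kernelVector : ∀ α β → proj₁ α (kernelVector β) ≈
                      proj₁ β b₁ * proj₁ α b₀ + - (proj₁ β b₀ * proj₁ α b₁)
  form-kernelVector α β = trans (form-lc α (proj₁ β b₁ ∷ const (- proj₁ β b₀)))
                                (+-congˡ (sym (-‿distribˡ-* _ _)))

  kernelVector-annihilated : ∀ α → proj₁ α (kernelVector α) ≈ 0#
  kernelVector-annihilated α = trans (form-kernelVector α α)
    (trans (+-congʳ (*-comm _ _)) (-‿inverseʳ _))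

  nonzero-on-basis : ∀ α → ¬ (α W*.≈ᴹ W*.0ᴹ) → ∃[ i ] ¬ (proj₁ α (basis i) ≈ 0#)
  nonzero-on-basis α α≉0 with proj₁ α b₀ ≟ 0# | proj₁ α b₁ ≟ 0#
  ... | no α₀≉0  | _         = zero , α₀≉0
  ... | yes _    | no α₁≉0   = suc zero , α₁≉0
  ... | yes α₀≈0 | yes α₁≈0  = contradiction (form-determined α W*.0ᴹ α₀≈0 α₁≈0) α≉0

  private
    ratio : ∀ {p q p′ q′} → ¬ (p ≈ 0#) → p * q′ ≈ q * p′ → ∃[ s ] (p′ ≈ s * p × q′ ≈ s * q)
    ratio {p} {q} {p′} {q′} p≉0 pq′≈qp′ with inverse p p≉0
    ... | u , pu≈1 = p′ * u , (begin
      p′             ≈⟨ *-identityʳ p′ ⟨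
      p′ * 1#        ≈⟨ *-congˡ (trans (*-comm u p) pu≈1) ⟨
      p′ * (u * p)   ≈⟨ *-assoc p′ u p ⟨
      p′ * u * p     ∎) , (begin
      q′             ≈⟨ *-identityˡ q′ ⟨
      1# * q′        ≈⟨ *-congʳ (trans (*-comm u p) pu≈1) ⟨
      u * p * q′     ≈⟨ *-assoc u p q′ ⟩
      u * (p * q′)   ≈⟨ *-congˡ (trans pq′≈qp′ (*-comm q p′)) ⟩
      u * (p′ * q)   ≈⟨ x∙yz≈y∙xz u p′ q ⟩
      p′ * (u * q)   ≈⟨ *-assoc p′ u q ⟨
      p′ * u * q     ∎)

    minors : ∀ α β → proj₁ α (kernelVector β) ≈ 0# →
             proj₁ β b₁ * proj₁ α b₀ ≈ proj₁ β b₀ * proj₁ α b₁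
    minors α β det≈0 = x-y≈0⇒x≈y (trans (sym (form-kernelVector α β)) det≈0)

  proportional : ∀ α β → ¬ (β W*.≈ᴹ W*.0ᴹ) → proj₁ α (kernelVector β) ≈ 0# →
                 ∃[ s ] α W*.≈ᴹ s W*.*ₗ β
  proportional α β β≉0 det≈0 with nonzero-on-basis β β≉0
  ... | zero , β₀≉0 =
    let s , α₀≈ , α₁≈ = ratio β₀≉0 (sym (minors α β det≈0))
    in s , form-determined α (s W*.*ₗ β) α₀≈ α₁≈
  ... | suc zero , β₁≉0 =
    let s , α₁≈ , α₀≈ = ratio β₁≉0 (minors α β det≈0)
    in s , form-determined α (s W*.*ₗ β) α₀≈ α₁≈

  -- The order makes these scalars distinct, which supplies as many non-proportional forms as
  -- required.
  fromℕ : ℕ → Carrier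
  fromℕ zero    = 0#
  fromℕ (suc n) = fromℕ n + 1#

  fromℕ-< : ∀ {i j} → i ℕ.< j → fromℕ i < fromℕ j
  fromℕ-< {i} {suc j} (ℕ.s≤s i≤j) with ℕ.m≤n⇒m<n∨m≡n i≤j
  ... | inj₁ i<j = <-trans (fromℕ-< i<j) (<-respˡ-≈ (+-identityʳ _) (+-monoʳ-< (fromℕ j) 0<1))
  ... | inj₂ ≡.refl = <-respˡ-≈ (+-identityʳ _) (+-monoʳ-< (fromℕ i) 0<1)

  fromℕ-injective : ∀ {i j} → fromℕ i ≈ fromℕ j → i ≡ j
  fromℕ-injective {i} {j} i≈j with ℕ.<-cmp i j
  ... | tri< i<j _ _ = contradiction (fromℕ-< i<j) (irrefl i≈j)
  ... | tri≈ _ i≡j _ = i≡j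
  ... | tri> _ _ j<i = contradiction (fromℕ-< j<i) (irrefl (sym i≈j))

  -- Stated by the determinant because that is the factor which evaluation at kernel vectors
  -- produces.
  PairwiseIndependent : ∀ {n} → Vector (LinearForm W) n → Set
  PairwiseIndependent α = ∀ {i j} → i ≢ j → ¬ (proj₁ (α i) (kernelVector (α j)) ≈ 0#)

  -- The forms with coordinates `1` and `i`; the determinant of the `i`-th and the `j`-th is
  -- `j - i`.
  pencil : ∀ {n} → Vector (LinearForm W) n
  pencil i = 1# W*.*ₗ e₀ W*.+ᴹ fromℕ (toℕ i) W*.*ₗ e₁

  pencil-pairwiseIndependent : ∀ {n} → PairwiseIndependent (pencil {n})
  pencil-pairwiseIndependent {n} {i} {j} i≢j det≈0 = i≢j (Fin.toℕ-injective (≡.sym (fromℕ-injective (begin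
    fromℕ (toℕ j)                                    ≈⟨ *-identityʳ _ ⟨
    fromℕ (toℕ j) * 1#                               ≈⟨ *-cong (combination-b₁ 1# _) (combination-b₀ 1# _) ⟨
    proj₁ (pencil j) b₁ * proj₁ (pencil i) b₀
      ≈⟨ minors (pencil i) (pencil j) det≈0 ⟩
    proj₁ (pencil j) b₀ * proj₁ (pencil i) b₁        ≈⟨ *-cong (combination-b₀ 1# _) (combination-b₁ 1# _) ⟩
    1# * fromℕ (toℕ i)                               ≈⟨ *-identityˡ _ ⟩
    fromℕ (toℕ i)                                    ∎))))

-- Independence and span of the powers in the symmetric tensors.

module Powers (ℝ : CompleteOrderedField) (W : RealGeometry.VectorSpace ℝ)
              (dim : RealGeometry.HasDimension ℝ W U 2) (m : ℕ) where
  open OrderedField ℝ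
  open RealGeometry ℝ hiding (module ℝ)
  open Veronese W m using (W*; SᵐW*)
  private
    T = TensorPower W* m
    module W* = Module W*
    module T = Module T
    module TL = LinearAlgebra ℝ T
    module SL = LinearAlgebra ℝ SᵐW*
  open Plane ℝ W dim
  open Multilinear ℝ W* T
  open TensorEvaluation ℝ W m
  open RawSemiringDefinitions (Semiring.rawSemiring semiring) using (_^_)

  power : LinearForm W → Tensor W* m
  power α = pure (λ _ → α)

  pure-multilinear : IsMultilinear pure
  pure-multilinear = record { cong = pure-cong ; +-homo = pure-+ ; *-homo = pure-* }

  -- Gives the upper bound on dimension. The spanning vectors are only known as elements of the full
  -- tensor power, so the count takes place there.
  powers-spanned : Σ (Vector (Tensor W* m) (suc m)) λ s → ∀ α → power α ∈ TL.Combinations s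
  powers-spanned = proj₁ expansion , λ α → monomials m (proj₁ α b₀) (proj₁ α b₁) ,
    ≋-trans (pure-cong {v = λ _ → α} {w = λ _ → proj₁ α b₀ W*.*ₗ e₀ W*.+ᴹ proj₁ α b₁ W*.*ₗ e₁}
              (λ _ → form-expansion α))
            (proj₂ expansion (proj₁ α b₀) (proj₁ α b₁))
    where expansion = diagonal-expansion pure-multilinear e₀ e₁

  power-proportional : ∀ {α β s} → α W*.≈ᴹ s W*.*ₗ β → power α T.≈ᴹ (s ^ m) ⊙ power β
  power-proportional {α} {β} {s} α≈sβ =
    ≋-trans (pure-cong {v = λ _ → α} {w = λ _ → s W*.*ₗ β} (λ _ → α≈sβ)) (diagonal-* pure-multilinear s β)

  module _ {n} {α : Vector (LinearForm W) n} {d : Vector Carrier n} {u : Vector (Tensor W* m) n}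
           (u≈dα : ∀ i → u i T.≈ᴹ d i ⊙ power (α i)) (d≉0 : ∀ i → ¬ (d i ≈ 0#))
           (α-pairwise : PairwiseIndependent α) where

    -- The `m` forms other than the `i`-th fill the `m` slots exactly, in the order of `punchIn i`.
    powers-independent-m+1 : n ≡ suc m → LinearlyIndependent T u
    powers-independent-m+1 ≡.refl = powers-independent α d u≈dα d≉0 λ i →
      (λ k → kernelVector (α (punchIn i k))) ,
      (λ k → α-pairwise (Fin.punchInᵢ≢i i k ∘ ≡.sym)) ,
      (λ j i≢j → punchOut i≢j , ≡.subst (λ l → proj₁ (α j) (kernelVector (α l)) ≈ 0#)
        (≡.sym (punchIn-punchOut i≢j)) (kernelVector-annihilated (α j)))

    -- Only `m - 1` other forms compete for `m` slots. Slot `j` carries the kernel of the `j`-th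
    -- form, and the spare slot `i` a basis vector on which the `i`-th form does not vanish.
    powers-independent-m : n ≡ m → (∀ i → ¬ (α i W*.≈ᴹ W*.0ᴹ)) → LinearlyIndependent T u
    powers-independent-m ≡.refl α≉0 = powers-independent α d u≈dα d≉0 λ i →
      updateAt (kernelVector ∘ α) i (const (basis (proj₁ (nonzero-on-basis (α i) (α≉0 i))))) ,
      nonvanishing i , λ j i≢j → j , trans
        (reflexive (≡.cong (proj₁ (α j)) (updateAt-minimal j i (kernelVector ∘ α) (i≢j ∘ ≡.sym))))
        (kernelVector-annihilated (α j))
      where
      nonvanishing : ∀ i k → ¬ (proj₁ (α i) (updateAt (kernelVector ∘ α) i
        (const (basis (proj₁ (nonzero-on-basis (α i) (α≉0 i))))) k) ≈ 0#)
      nonvanishing i k with i Fin.≟ k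
      ... | yes ≡.refl = ≡.subst (λ w → ¬ (proj₁ (α i) w ≈ 0#))
        (≡.sym (updateAt-updates i (kernelVector ∘ α))) (proj₂ (nonzero-on-basis (α i) (α≉0 i)))
      ... | no i≢k = ≡.subst (λ w → ¬ (proj₁ (α i) w ≈ 0#))
        (≡.sym (updateAt-minimal k i (kernelVector ∘ α) (i≢k ∘ ≡.sym))) (α-pairwise i≢k)

  φ-lc : ∀ {n} (c : Vector Carrier n) (u : Vector ∣ SᵐW* ∣ n) →
         proj₁ (SL.lc c u) T.≈ᴹ TL.lc c (proj₁ ∘ u)
  φ-lc {zero}  c u = ≋-refl
  φ-lc {suc n} c u = ⊕-cong ≋-refl (φ-lc (tail c) (tail u))

  independent-φ : ∀ {n} {u : Vector ∣ SᵐW* ∣ n} → LinearlyIndependent SᵐW* u →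
                  LinearlyIndependent T (proj₁ ∘ u)
  independent-φ {u = u} independent c cu≈0 = independent c (≋-trans (φ-lc c u) cu≈0)

  φ-independent : ∀ {n} {u : Vector ∣ SᵐW* ∣ n} → LinearlyIndependent T (proj₁ ∘ u) →
                  LinearlyIndependent SᵐW* u
  φ-independent {u = u} independent c cu≈0 = independent c (≋-trans (≋-sym (φ-lc c u)) cu≈0)

  φ-preimage : ∀ {n} (s : Vector (Tensor W* m) n) →
               IsSubspace SᵐW* (λ x → proj₁ x ∈ TL.Combinations s)
  φ-preimage s = record
    { resp = λ {x} {y} → resp {proj₁ x} {proj₁ y}
    ; 0∈   = 0∈
    ; +∈   = λ {x} {y} → +∈ {proj₁ x} {proj₁ y}
    ; *∈   = λ a {x} → *∈ a {proj₁ x}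
    }
    where
    open IsSubspace (TL.combinations-isSubspace s)

  symmetricPower : LinearForm W → ∣ SᵐW* ∣
  -- A constant tuple is definitionally unchanged by reindexing.
  symmetricPower α = power α , λ _ → ≋-refl

  -- The lower bound on the dimension of `SᵐW*`.
  pencil-powers-independent : LinearlyIndependent SᵐW* (λ (i : Fin (suc m)) → symmetricPower (pencil i))
  pencil-powers-independent = φ-independent {u = symmetricPower ∘ pencil}
    (powers-independent-m+1 {α = pencil} {d = const 1#} (λ i → ≋-sym (⊙-identityˡ _)) (λ _ → 1≉0)
      pencil-pairwiseIndependent ≡.refl)

-- Listing a decidable subset of a finite set.

Enumeration : ∀ {k} → Pred (Fin k) 0ℓ → ℕ → Set
Enumeration {k} P n = Σ (Fin n → Fin k) λ e →
  (∀ {i j} → e i ≡ e j → i ≡ j) × (∀ i → e i ∈ P) × (∀ j → j ∈ P → ∃[ i ] e i ≡ j)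

-- Turns the set of generators in a facet into a list without repetition, whose length can be
-- compared with `m`.
enumerate : ∀ {k} {P : Pred (Fin k) 0ℓ} → Decidable P → ∃ (Enumeration P)
enumerate {zero}  P? = zero , (λ ()) , (λ { {()} }) , (λ ()) , λ ()
enumerate {suc k} {P} P? with P? zero | enumerate (P? ∘ suc)
... | no ¬p₀ | n , e , injective , sound , complete =
  n , suc ∘ e , injective ∘ Fin.suc-injective , sound , complete′
  where
  complete′ : ∀ j → j ∈ P → ∃[ i ] suc (e i) ≡ j
  complete′ zero    p = contradiction p ¬p₀
  complete′ (suc j) p with complete j p
  ... | i , ei≡j = i , ≡.cong suc ei≡j
... | yes p₀ | n , e , injective , sound , complete =
  suc n , e′ , injective′ , sound′ , complete′
  where
  e′ : Fin (suc n) → Fin (suc k)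
  e′ zero    = zero
  e′ (suc i) = suc (e i)
  injective′ : ∀ {i j} → e′ i ≡ e′ j → i ≡ j
  injective′ {zero}  {zero}  _ = ≡.refl
  injective′ {suc i} {suc j} p = ≡.cong suc (injective (Fin.suc-injective p))
  sound′ : ∀ i → e′ i ∈ P
  sound′ zero    = p₀
  sound′ (suc i) = sound i
  complete′ : ∀ j → j ∈ P → ∃[ i ] e′ i ≡ j
  complete′ zero    _ = zero , ≡.refl
  complete′ (suc j) p with complete j p
  ... | i , ei≡j = suc i , ≡.cong suc ei≡j

-- Facets of a cone with extremal rays on the Veronese curve.

module VeroneseCone
  (ℝ : CompleteOrderedField) (W : RealGeometry.VectorSpace ℝ)
  (dim : RealGeometry.HasDimension ℝ W U 2) (m : ℕ)
  where

  open OrderedField ℝ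
  open RealGeometry ℝ hiding (module ℝ)
  open Veronese W m
  private
    T = TensorPower W* m
    module W* = Module W*
    module T = Module T
    module TL = LinearAlgebra ℝ T
    module SL = LinearAlgebra ℝ SᵐW*
  open Plane ℝ W dim using (PairwiseIndependent; proportional; pencil)
  open Powers ℝ W dim m
  open Cones ℝ SᵐW*

  module _
    {σ∨ : Pred ∣ SᵐW* ∣ 0ℓ} (pointed : IsPointed SᵐW* σ∨) (full : IsFullDimensional SᵐW* σ∨)
    (onCurve : ∀ R → IsExtremalRay SᵐW* σ∨ R → ∃[ t ] R ⊆ ψ t)
    {k} {g : Vector ∣ SᵐW* ∣ k} (σ≐hull : σ∨ ≐ ConicalHull SᵐW* g) (irredundant : ¬ Redundant g)
    where

    open IrredundantlyGenerated pointed σ≐hull irredundant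

    -- The curve hypothesis concerns extremal rays; it reaches the generators because each of them
    -- spans one.
    rayPoint : ∀ j → ∃[ t ] g j ∈ ψ t
    rayPoint j = proj₁ point , proj₂ point {g j} (generator∈ray (g j))
      where point = onCurve (Ray (g j)) (ray-isExtremal j)

    α : Vector (LinearForm W) k
    α j = proj₁ (proj₂ (rayPoint j))

    α≉0 : ∀ j → ¬ (α j W*.≈ᴹ W*.0ᴹ)
    α≉0 j = proj₁ (proj₂ (proj₂ (proj₂ (rayPoint j))))

    d : Vector Carrier k
    d j = proj₁ (proj₂ (proj₂ (proj₂ (proj₂ (rayPoint j)))))

    g≈dα : ∀ j → proj₁ (g j) T.≈ᴹ d j ⊙ power (α j)
    g≈dα j = proj₂ (proj₂ (proj₂ (proj₂ (proj₂ (rayPoint j)))))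

    d≉0 : ∀ j → ¬ (d j ≈ 0#)
    d≉0 j d≈0 = g≉0 j (≋-trans (g≈dα j) (≋-trans (⊙-cong d≈0 ≋-refl) (⊙-zeroˡ _)))

    -- From `α i = s α j` the `m`-th powers differ by `s ^ m`. With `u` the inverse of `d j`, this
    -- makes `g i` the multiple `d i * (s ^ m * u)` of `g j`.
    α-pairwiseIndependent : PairwiseIndependent α
    α-pairwiseIndependent {i} {j} i≢j det≈0 = not-proportional i≢j (d i * (s ^ m * u))
      (≋-trans (g≈dα i) (≋-trans (⊙-cong refl (≋-trans (power-proportional {α i} {α j} (proj₂ ratio))
        (≋-trans (⊙-cong refl (≋-sym (≋-trans (⊙-cong refl (g≈dα j)) (TL.*ₗ-inverse (proj₂ inv) _))))
          (≋-sym (⊙-assoc (s ^ m) u (proj₁ (g j)))))))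
        (≋-sym (⊙-assoc (d i) (s ^ m * u) (proj₁ (g j))))))
      where
      open RawSemiringDefinitions (Semiring.rawSemiring semiring) using (_^_)
      ratio = proportional (α i) (α j) (α≉0 j) det≈0
      s = proj₁ ratio
      inv = inverse (d j) (d≉0 j)
      u = proj₁ inv

    subfamily-pairwiseIndependent : ∀ {n} (e : Fin n → Fin k) → (∀ {i j} → e i ≡ e j → i ≡ j) →
                                    PairwiseIndependent (α ∘ e)
    subfamily-pairwiseIndependent e injective i≢j = α-pairwiseIndependent (i≢j ∘ injective)

    -- The exchange inequality is applied twice: in the tensor power against the spanning vectors of
    -- all powers, and in `SᵐW*` to the powers of `pencil`, which `full` places in the span of the
    -- cone.
    span-dimension : ∀ {n} → HasConeDimension SᵐW* σ∨ n → n ≡ suc m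
    span-dimension {n} (b , b∈ , b-independent , b-spans) = ℕ.≤-antisym
      (TL.steinitz {v = proj₁ ∘ b} {b = s} (independent-φ {u = b} b-independent) (λ i → spanned {b i} (b∈ i)))
      (SL.steinitz {v = λ (i : Fin (suc m)) → symmetricPower (pencil i)} {b = b} pencil-powers-independent
        (λ i → b-spans (symmetricPower (pencil i)) (full (symmetricPower (pencil i)))))
      where
      s = proj₁ powers-spanned
      L : Pred ∣ SᵐW* ∣ 0ℓ
      L x = proj₁ x ∈ TL.Combinations s
      L-isSubspace : IsSubspace SᵐW* L
      L-isSubspace = φ-preimage s
      g∈L : ∀ i → g i ∈ L
      g∈L i = resp (≋-sym (g≈dα i)) (*∈ (d i) (proj₂ powers-spanned (α i)))
        where
        open IsSubspace (TL.combinations-isSubspace s)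
      spanned : Span SᵐW* σ∨ ⊆ L
      spanned {x} = SL.span-minimal {S = σ∨} {L = L} L-isSubspace (λ {y} y∈σ →
        IsSubspace.resp L-isSubspace {x = SL.lc (proj₁ (proj₁ σ≐hull y∈σ)) g} {y}
          (≋-sym (proj₂ (proj₂ (proj₁ σ≐hull y∈σ))))
          (SL.subspace-lc {L = L} L-isSubspace g∈L)) {x}

    module _ {F : Pred ∣ SᵐW* ∣ 0ℓ} (F-face : IsFace SᵐW* σ∨ F)
             (F-dimension : HasConeDimension SᵐW* F m) where

      private
        b = proj₁ F-dimension
        b∈spanF = proj₁ (proj₂ F-dimension)
        b-independent = proj₁ (proj₂ (proj₂ F-dimension))
        b-spans = proj₂ (proj₂ (proj₂ F-dimension))

      at-least-m : ∀ {n} → Enumeration (λ j → g j ∈ F) n → m ℕ.≤ n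
      at-least-m (e , _ , _ , complete) = SL.steinitz {v = b} {b = g ∘ e} b-independent
        (λ i → SL.span-minimal {S = F} (SL.combinations-isSubspace (g ∘ e))
          (λ {x} → face-generated F-face (SL.combinations-isSubspace (g ∘ e)) generators {x})
          {b i} (b∈spanF i))
        where
        generators : ∀ j → g j ∈ F → g j ∈ SL.Combinations (g ∘ e)
        generators j gj∈F = ≡.subst (λ l → g l ∈ SL.Combinations (g ∘ e)) (proj₂ (complete j gj∈F))
          (SL.generator∈combinations (g ∘ e) (proj₁ (complete j gj∈F)))

      at-most-m : ∀ {n} → Enumeration (λ j → g j ∈ F) n → n ℕ.≤ m
      at-most-m {n} (e , injective , sound , _) = ℕ.≮⇒≥ λ m<n →
        -- The first `suc m` generators of the list are independent, yet lie in the span of `m`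
        -- vectors.
        let e′ = λ (i : Fin (suc m)) → e (inject≤ i m<n) in
        ℕ.<-irrefl ≡.refl (SL.steinitz {v = g ∘ e′} {b = b}
          (φ-independent {u = g ∘ e′} (powers-independent-m+1 (g≈dα ∘ e′) (d≉0 ∘ e′)
            (subfamily-pairwiseIndependent e′ (Fin.inject≤-injective m<n m<n _ _ ∘ injective)) ≡.refl))
          (λ i → b-spans (g (e′ i)) (SL.⊆span {S = F} (sound (inject≤ i m<n)))))

      rays-in-facet : Enumeration (λ j → g j ∈ F) m →
        Σ (Vector (Pred ∣ SᵐW* ∣ 0ℓ) m) λ ρ →
          AreTheExtremalRaysIn SᵐW* σ∨ F ρ × LinearlyIndependentRays SᵐW* ρ
      rays-in-facet (e , injective , sound , complete) = ρ , record
        { isExtremalRay = λ i → ray-isExtremal (e i)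
        ; ρ⊆F           = λ i → ray⊆face F-face (sound i)
        ; distinct      = λ i j (i⊆j , _) → injective (ray-injective (λ {x} → i⊆j {x}))
        ; exhaustive    = exhaustive
        } , independent
        where
        ρ : Vector (Pred ∣ SᵐW* ∣ 0ℓ) m
        ρ i = Ray (g (e i))
        exhaustive : ∀ R → IsExtremalRay SᵐW* σ∨ R → R ⊆ F → ∃[ i ] R ≐ ρ i
        exhaustive R R-extremal R⊆F =
          let j , R≐ray = extremalRay-classification R-extremal
              i , ei≡j  = complete j (R⊆F (proj₂ R≐ray (generator∈ray (g j))))
          in i , ≡.subst (λ l → R ≐ Ray (g l)) (≡.sym ei≡j) R≐ray
        independent : LinearlyIndependentRays SᵐW* ρ
        -- Arbitrary nonzero vectors on the rays are again nonzero multiples of powers: the ray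
        -- parameter multiplies the factor `d (e i)`.
        independent v v∈ρ v≉0 = φ-independent {u = v}
          (powers-independent-m {α = α ∘ e} {d = λ i → proj₁ (v∈ρ i) * d (e i)} v≈tdα
            (λ i → *-nonzero (t≉0 i) (d≉0 (e i)))
            (subfamily-pairwiseIndependent e injective) ≡.refl (α≉0 ∘ e))
          where
          v≈tdα : ∀ i → proj₁ (v i) T.≈ᴹ (proj₁ (v∈ρ i) * d (e i)) ⊙ power (α (e i))
          v≈tdα i = ≋-trans (proj₂ (proj₂ (v∈ρ i)))
            (≋-trans (⊙-cong refl (g≈dα (e i))) (≋-sym (⊙-assoc _ _ _)))
          t≉0 : ∀ i → ¬ (proj₁ (v∈ρ i) ≈ 0#)
          t≉0 i t≈0 = v≉0 i (≋-trans (proj₂ (proj₂ (v∈ρ i)))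
            (≋-trans (⊙-cong t≈0 ≋-refl) (⊙-zeroˡ _)))

    simplicial : IsConeOverSimplicialPolytope SᵐW* σ∨ m
    simplicial F (F-face , n , F-dim , σ-dim) = rays-in-facet F-face F-dimension
      (≡.subst (Enumeration (λ j → g j ∈ F))
        (ℕ.≤-antisym (at-most-m F-face F-dimension rays) (at-least-m F-face F-dimension rays)) rays)
      where
      -- A facet only comes with some pair `n`, `suc n` of dimensions; that of the cone identifies
      -- `n` with `m`.
      F-dimension : HasConeDimension SᵐW* F m
      F-dimension = ≡.subst (HasConeDimension SᵐW* F) (ℕ.suc-injective (span-dimension σ-dim)) F-dim
      rays = proj₂ (enumerate (λ j → excludedMiddle (g j ∈ F)))

theorem3p5 : (ℝ : CompleteOrderedField) →
    let open RealGeometry ℝ in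
    (W : VectorSpace) → HasDimension W U 2 →
    (m : ℕ) → 2 ℕ.≤ m →
    let open Veronese W m in
    (σ∨ : Pred ∣ SᵐW* ∣ 0ℓ) →
    IsConvexPolyhedralCone SᵐW* σ∨ →
    IsFullDimensional SᵐW* σ∨ →
    IsPointed SᵐW* σ∨ →
    (∀ R → IsExtremalRay SᵐW* σ∨ R → ∃[ t ] R ⊆ ψ t) →
    IsConeOverSimplicialPolytope SᵐW* σ∨ m
theorem3p5 ℝ W dim m _ σ∨ (k , g , σ⊆ , ⊆σ) full pointed onCurve =
  -- The given generators may include vectors on no extremal ray, about which the curve hypothesis
  -- says nothing, so they are thinned out beforehand.
  let SᵐW* = RealGeometry.Veronese.SᵐW* ℝ W m
      k′ , g′ , irredundant , g⊆ , ⊆g = Cones.irredundantGenerators ℝ SᵐW* g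
  in VeroneseCone.simplicial ℝ W dim m pointed full onCurve
       ((λ {x} x∈σ → g⊆ {x} (σ⊆ {x} x∈σ)) , (λ {x} x∈hull → ⊆σ {x} (⊆g {x} x∈hull))) irredundant
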